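{- Let $P$ be any finite poset. Then, as $n\to\infty$, $$\operatorname{La}^{\#*}(n,P)\sim\frac{|P|}{c^*(P)}\binom{n}{\lfloor n/2\rfloor},$$ where $\operatorname{La}^{\#*}(n,P)$ and $c^*(P)$ are as defined in the context.
   Context: For $n\ge 0$, $\mathcal{B}_n$ denotes the Boolean lattice: the family of all subsets of $[n]=\{1,\dots,n\}$ ordered by inclusion. A strong embedding of a finite poset $P$ into $\mathcal{B}_n$ is an injective map $f:P\to\mathcal{B}_n$ such that for all $a,b\in P$, $a<b$ if and only if $f(a)\subsetneq f(b)$; its image $f(P)$ is called an induced copy of $P$ in $\mathcal{B}_n$. Induced copies $\mathcal{F}_1,\mathcal{F}_2,\dots$ of $P$ are pairwise unrelated if whenever $i\ne j$, $A\in\mathcal{F}_i$ and $A'\in\mathcal{F}_j$, the sets $A$ and $A'$ are incomparable under inclusion. $\operatorname{La}^{\#*}(n,P)$ denotes the maximum of $|\bigcup_i\mathcal{F}_i|$ over all families of pairwise unrelated induced copies $\mathcal{F}_i$ of $P$ in $\mathcal{B}_n$. For $\mathcal{F}\subseteq\mathcal{B}_k$, its convex closure is $\overline{\mathcal{F}}=\{S\in\mathcal{B}_k : A\subseteq S\subseteq B \text{ for some } A,B\in\mathcal{F}\}$. Finally, $c^*(P)$ is the minimum of $|\overline{f(P)}|$ over all $k\ge0$ and all strong embeddings $f$ of $P$ into $\mathcal{B}_k$. -}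

module Defs where

open import Data.Nat using (ℕ; zero; suc; _+_; _*_; _≤_; ∣_-_∣)
open import Data.Nat.DivMod using (_/_)
open import Data.Nat.Combinatorics using (_C_)
open import Data.Fin using (Fin)
open import Data.Fin.Subset using (Subset; _⊆_)
open import Data.List using (List; length)
open import Data.List.Membership.Propositional using (_∈_)
open import Data.List.Relation.Unary.Unique.Propositional using (Unique)
open import Data.Product using (Σ; ∃; ∃-syntax; _×_)
open import Function.Bundles using (_⇔_)
open import Relation.Nullary using (¬_)
open import Relation.Binary.PropositionalEquality using (_≡_; _≢_)
open import Relation.Binary.Structures using (IsPartialOrder)

record FinPoset : Set₁ where
  field
    size : ℕ
    _≤ₚ_ : Fin size → Fin size → Set
    isPartialOrder : IsPartialOrder _≡_ _≤ₚ_

  _<ₚ_ : Fin size → Fin size → Set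
  a <ₚ b = (a ≤ₚ b) × (a ≢ b)

open FinPoset public

_⊊_ : ∀ {n} → Subset n → Subset n → Set
A ⊊ B = (A ⊆ B) × (A ≢ B)

HasSize : ∀ {A : Set} → (A → Set) → ℕ → Set
HasSize {A} Q m = Σ (List A) λ xs → Unique xs × (∀ x → (x ∈ xs) ⇔ Q x) × (length xs ≡ m)

StrongEmbedding : (P : FinPoset) (n : ℕ) → (Fin (size P) → Subset n) → Set
StrongEmbedding P n f =
  (∀ a b → f a ≡ f b → a ≡ b) ×
  (∀ a b → (_<ₚ_ P a b → f a ⊊ f b) × (f a ⊊ f b → _<ₚ_ P a b))

Incomparable : ∀ {n} → Subset n → Subset n → Set
Incomparable A B = ¬ (A ⊆ B) × ¬ (B ⊆ A)

PairwiseUnrelated : (P : FinPoset) (n t : ℕ) → (Fin t → Fin (size P) → Subset n) → Set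
PairwiseUnrelated P n t F = ∀ i j → i ≢ j → ∀ a b → Incomparable (F i a) (F j b)

InUnion : (P : FinPoset) (n t : ℕ) → (Fin t → Fin (size P) → Subset n) → Subset n → Set
InUnion P n t F S = ∃[ i ] ∃[ a ] (F i a ≡ S)

LaAchievable : FinPoset → ℕ → ℕ → Set
LaAchievable P n m =
  ∃[ t ] Σ (Fin t → Fin (size P) → Subset n) λ F →
    (∀ i → StrongEmbedding P n (F i)) × PairwiseUnrelated P n t F × HasSize (InUnion P n t F) m

IsLa : FinPoset → ℕ → ℕ → Set
IsLa P n m = LaAchievable P n m × (∀ m' → LaAchievable P n m' → m' ≤ m)

InConvexClosure : (P : FinPoset) (k : ℕ) → (Fin (size P) → Subset k) → Subset k → Set
InConvexClosure P k f S = ∃[ a ] ∃[ b ] (f a ⊆ S × S ⊆ f b)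

CAchievable : FinPoset → ℕ → Set
CAchievable P c =
  ∃[ k ] Σ (Fin (size P) → Subset k) λ f →
    StrongEmbedding P k f × HasSize (InConvexClosure P k f) c

IsCStar : FinPoset → ℕ → Set
IsCStar P c = CAchievable P c × (∀ c' → CAchievable P c' → c ≤ c')

centralBinom : ℕ → ℕ
centralBinom n = n C (n / 2)

{-# OPTIONS --safe #-}
module Submission where

-- Upper bound: for unrelated copies, a maximal chain meets the convex closure of at most one of them. By
-- Bonferroni, c* sets in a closure are met by at least (1 - c*/n) c* n!/B chains, B the central binomial
-- coefficient: each single set lies on at least n!/B chains, and two proper sets lie jointly on at most
-- a 1/n fraction of the sum of their chain numbers.
--
-- Lower bound: take f : P → 𝓑_K with closure G, |G| = c*. On [K] ⊔ [n - K], the copies f(P) + A, with A in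
-- a fixed near-middle level of [n - K], occupy the blocks T + 2^[n-K], T ∈ G. Each of the other 2^K - c*
-- blocks is filled recursively, in a band of levels above the fixed one if T lies below some member of G
-- and below it otherwise, larger T getting lower bands; by convexity of G nothing becomes comparable.
-- After d rounds a fraction 1 - (1 - c*/2^K)^d of the middle binomial coefficient is covered.

open import Defs
open import Data.Nat
open import Data.Nat.Properties
open import Data.Nat.Combinatorics using (_C_; nCk≡n!/k![n-k]!; k![n∸k]!∣n!; nCk+nC[k+1]≡[n+1]C[k+1]; k>n⇒nCk≡0; nC1≡n)
open import Data.Nat.DivMod using (_/_; _%_; m≡m%n+[m/n]*n; m%n<n; m/n*n≡m; m/n*n≤m; m*n/n≡m; /-monoˡ-≤)
open import Data.Nat.Tactic.RingSolver using (solve-∀)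
open import Data.Bool using (Bool; true; false; not; _∧_; _∨_; if_then_else_)
open import Data.Bool.ListAction using (any)
open import Data.Bool.Properties using (∧-comm; ∧-zeroʳ; ∧-identityʳ)
open import Data.Empty using (⊥-elim)
open import Data.Fin using (Fin; zero; suc; fromℕ<; funToFin; finToFun)
import Data.Fin.Properties as Fin
open import Data.Fin.Subset using (Subset; _⊆_; _∈_; ∁; inside; outside) renaming (∣_∣ to #_)
open import Data.Fin.Subset.Properties using (drop-∷-⊆; s⊆s; out⊆; ⊆-refl; ⊆-reflexive; ⊆-trans; ⊆-antisym; ∣p∣≤n; p⊆q⇒∣p∣≤∣q∣; p⊆q⇒∁p⊇∁q; _⊆?_; _∈?_)
open import Data.List as List using (List; []; _∷_; _++_; map; length; allFin; tabulate; take; filter; concat; cartesianProduct)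
open import Data.List.Membership.Propositional using () renaming (_∈_ to _∈ˡ_)
open import Data.List.Membership.Propositional.Properties
open import Data.List.Properties using (length-++; length-++-sucʳ; length-filter; length-map; length-tabulate; length-take)
open import Data.List.Relation.Unary.All as All using (All; []; _∷_)
import Data.List.Relation.Unary.All.Properties as All
open import Data.List.Relation.Unary.AllPairs as AllPairs using (AllPairs; []; _∷_)
import Data.List.Relation.Unary.AllPairs.Properties as AllPairs
open import Data.List.Relation.Unary.Any using (here; there)
open import Data.List.Relation.Unary.Unique.Propositional using (Unique)
import Data.List.Relation.Unary.Unique.Propositional.Properties as Unique
open import Data.Product using (_,_; _×_; proj₁; proj₂; ∃-syntax)
open import Data.Sum using (_⊎_; inj₁; inj₂; [_,_]′)
open import Data.Unit using (⊤; tt)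
open import Data.Vec as Vec using ([]; _∷_; lookup; removeAt) renaming (_++_ to _⧺_; here to hereᵛ)
open import Data.Vec.Properties using (lookup⇒[]=; []=⇒lookup; lookup∘tabulate; removeAt-punchOut)
open import Function.Bundles using (Equivalence; mk⇔)
open import Relation.Nullary using (¬_; Dec; yes; no; does; ¬?)
open import Relation.Nullary.Decidable using (_×-dec_; dec-true)
open import Relation.Binary.PropositionalEquality

-- Factorials and binomial coefficients

-- Unrelated copies are disjoint, so `t` of them cover `t * size P` sets, and both halves reduce to
-- comparing `t * c` with the central binomial coefficient. The tolerance `1/(k+1)` is fixed
-- beforehand, and every estimate is an integer inequality with denominators cleared. Two obstacles
-- shape the upper bound. The closure of a copy may be far larger than c*, even larger than n, which
-- would spoil the Bonferroni error; so only c* of its members are kept. And the empty and full sets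
-- lie on all chains; a second copy keeps them out of every closure. In the lower bound, the number
-- of rounds and the block dimension depend only on `size P` and `k`. All bands together therefore
-- span a bounded number of levels just above the middle, where the binomial coefficients differ
-- from the central one by a vanishing fraction, and a single lower bound `θ` serves for every level
-- used. Splitting off `q` coordinates loses nothing to leading order, because the central
-- coefficient of `q + r` is at most `2 ^ q` times that of `r`.

binomial-factorial : ∀ a b → ((a + b) C a) * (a ! * b !) ≡ (a + b) !
binomial-factorial a b = begin
  ((a + b) C a) * (a ! * b !)             ≡⟨ cong (λ z → ((a + b) C a) * (a ! * z !)) (sym (m+n∸m≡n a b)) ⟩
  ((a + b) C a) * (a ! * (a + b ∸ a) !)   ≡⟨ cong (_* (a ! * (a + b ∸ a) !)) (nCk≡n!/k![n-k]! (m≤m+n a b)) ⟩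
  _                                     ≡⟨ m/n*n≡m {{a !* (a + b ∸ a) !≢0}} (k![n∸k]!∣n! (m≤m+n a b)) ⟩
  (a + b) !                             ∎
  where open ≡-Reasoning

-- Log-convexity of the factorial: the `e` factors that lead from `a !` to `(e + a) !` are, one by
-- one, at most those that lead from `g !` to `(e + g) !`.
factorial-spread : ∀ e {a g} → a ≤ g → (e + a) ! * g ! ≤ a ! * (e + g) !
factorial-spread zero    a≤g = ≤-refl
factorial-spread (suc e) {a} {g} a≤g = begin
  (suc e + a) * (e + a) ! * g !     ≡⟨ *-assoc (suc e + a) ((e + a) !) (g !) ⟩
  (suc e + a) * ((e + a) ! * g !)   ≤⟨ *-mono-≤ (+-monoʳ-≤ (suc e) a≤g) (factorial-spread e a≤g) ⟩
  (suc e + g) * (a ! * (e + g) !)   ≡⟨ swap (suc e + g) (a !) _ ⟩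
  a ! * (suc e + g) !               ∎
  where
  open ≤-Reasoning
  swap : ∀ x y z → x * (y * z) ≡ y * (x * z)
  swap = solve-∀

-- A binomial coefficient `(a + b) C a` off the two ends is at least `a + b`. This is the source of
-- the factor `1/n` for pairs of sets on a common chain.
factorial-product : ∀ {a b} → 1 ≤ a → 1 ≤ b → (a + b) * (a ! * b !) ≤ (a + b) !
factorial-product {suc a} {b} _ 1≤b = *-monoʳ-≤ (suc a + b) (begin
  suc a ! * b !    ≡⟨ cong (λ z → z ! * b !) (+-comm 1 a) ⟩
  (a + 1) ! * b !  ≤⟨ factorial-spread a 1≤b ⟩
  1 * (a + b) !    ≡⟨ *-identityˡ _ ⟩
  (a + b) !        ∎)
  where open ≤-Reasoning

factorial-balance-≤ : ∀ {a b h g} → a + b ≡ h + g → h ≤ g → g ≤ suc h → a ≤ b → h ! * g ! ≤ a ! * b !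
factorial-balance-≤ {a} {b} {h} {g} eq h≤g g≤ a≤b with a ≤? h
... | no a≰h = ⊥-elim (1+n≰n (begin
    suc (h + g)        ≤⟨ s≤s (+-monoʳ-≤ h g≤) ⟩
    suc h + suc h      ≤⟨ +-mono-≤ (≰⇒> a≰h) (≤-trans (≰⇒> a≰h) a≤b) ⟩
    a + b              ≡⟨ eq ⟩
    h + g              ∎))
  where open ≤-Reasoning
... | yes a≤h = begin
  h ! * g !              ≡⟨ cong (λ z → z ! * g !) (sym (m∸n+n≡m a≤h)) ⟩
  (h ∸ a + a) ! * g !    ≤⟨ factorial-spread (h ∸ a) (≤-trans a≤h h≤g) ⟩
  a ! * (h ∸ a + g) !    ≡⟨ cong (λ z → a ! * z !) (sym b≡) ⟩
  a ! * b !              ∎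
  where
  open ≤-Reasoning
  b≡ : b ≡ h ∸ a + g
  b≡ = +-cancelˡ-≡ a b _ (trans eq (trans (cong (_+ g) (sym (m+[n∸m]≡n a≤h))) (+-assoc a _ g)))

factorial-balance : ∀ {a b h g} → a + b ≡ h + g → h ≤ g → g ≤ suc h → h ! * g ! ≤ a ! * b !
factorial-balance {a} {b} {h} {g} eq h≤g g≤ with ≤-total a b
... | inj₁ a≤b = factorial-balance-≤ eq h≤g g≤ a≤b
... | inj₂ b≤a = ≤-trans (factorial-balance-≤ (trans (+-comm b a) eq) h≤g g≤ b≤a)
                         (≤-reflexive (*-comm (b !) (a !)))

half : ℕ → ℕ
half n = n / 2

cohalf : ℕ → ℕ
cohalf n = half n + n % 2

half+cohalf : ∀ n → half n + cohalf n ≡ n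
half+cohalf n = trans (rearrange (half n) (n % 2)) (sym (m≡m%n+[m/n]*n n 2))
  where
  rearrange : ∀ h ε → h + (h + ε) ≡ ε + h * 2
  rearrange = solve-∀

half≤cohalf : ∀ n → half n ≤ cohalf n
half≤cohalf n = m≤m+n (half n) (n % 2)

cohalf≤1+half : ∀ n → cohalf n ≤ suc (half n)
cohalf≤1+half n = ≤-trans (+-monoʳ-≤ (half n) (s≤s⁻¹ (m%n<n n 2))) (≤-reflexive (+-comm (half n) 1))

-- The number of maximal chains through a set of the middle level, which is the least number through
-- any set; times `centralBinom n` it gives `n !`.
minFactorials : ℕ → ℕ
minFactorials n = half n ! * cohalf n !

minFactorials≢0 : ∀ n → NonZero (minFactorials n)
minFactorials≢0 n = half n !* cohalf n !≢0

minFactorials-min : ∀ {a b n} → a + b ≡ n → minFactorials n ≤ a ! * b !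
minFactorials-min {a} {b} {n} eq = factorial-balance {a} {b} (trans eq (sym (half+cohalf n))) (half≤cohalf n) (cohalf≤1+half n)

centralBinom-factorial : ∀ n → centralBinom n * minFactorials n ≡ n !
centralBinom-factorial n =
  subst (λ z → (z C half n) * minFactorials n ≡ z !) (half+cohalf n) (binomial-factorial (half n) (cohalf n))

binomial≤central : ∀ n j → n C j ≤ centralBinom n
binomial≤central n j with j ≤? n
... | no j≰n = ≤-trans (≤-reflexive (k>n⇒nCk≡0 (≰⇒> j≰n))) z≤n
... | yes j≤n = *-cancelʳ-≤ (n C j) _ (minFactorials n) {{minFactorials≢0 n}} (begin
  (n C j) * minFactorials n          ≤⟨ *-monoʳ-≤ (n C j) (minFactorials-min {j} {n ∸ j} eq) ⟩
  (n C j) * (j ! * (n ∸ j) !)        ≡⟨ subst (λ z → (z C j) * (j ! * (n ∸ j) !) ≡ z !) eq (binomial-factorial j (n ∸ j)) ⟩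
  n !                              ≡⟨ sym (centralBinom-factorial n) ⟩
  centralBinom n * minFactorials n ∎)
  where
  open ≤-Reasoning
  eq : j + (n ∸ j) ≡ n
  eq = m+[n∸m]≡n j≤n

n≤centralBinom : ∀ n → n ≤ centralBinom n
n≤centralBinom n = subst (_≤ centralBinom n) (nC1≡n n) (binomial≤central n 1)

binomial-doubling-upper : ∀ q r j → (q + r) C j ≤ 2 ^ q * centralBinom r
binomial-doubling-upper zero r j = ≤-trans (binomial≤central r j) (≤-reflexive (sym (*-identityˡ _)))
binomial-doubling-upper (suc q) r zero = ≤-trans (binomial-doubling-upper q r zero)
  (*-monoˡ-≤ (centralBinom r) (m≤m+n (2 ^ q) _))
binomial-doubling-upper (suc q) r (suc j) = begin
  (suc (q + r) C suc j)                   ≡⟨ sym (nCk+nC[k+1]≡[n+1]C[k+1] (q + r) j) ⟩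
  ((q + r) C j) + ((q + r) C suc j)         ≤⟨ +-mono-≤ (binomial-doubling-upper q r j) (binomial-doubling-upper q r (suc j)) ⟩
  2 ^ q * centralBinom r + 2 ^ q * centralBinom r ≡⟨ twice (2 ^ q) (centralBinom r) ⟩
  2 ^ suc q * centralBinom r            ∎
  where
  open ≤-Reasoning
  twice : ∀ x y → x * y + x * y ≡ (2 * x) * y
  twice = solve-∀

-- By Pascal's rule `(q + r) C j` is a sum of `2 ^ q` coefficients `r C i`, counted with
-- multiplicity, with `i` between `j - q` and `j`; hence the window shrinks by `q` at its lower end
-- only.
binomial-doubling-lower : ∀ {r θ lo hi} → (∀ j → lo ≤ j → j ≤ hi → θ ≤ r C j) →
  ∀ q j → lo + q ≤ j → j ≤ hi → 2 ^ q * θ ≤ (q + r) C j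
binomial-doubling-lower {lo = lo} θ≤ zero j lo≤j j≤hi =
  ≤-trans (≤-reflexive (*-identityˡ _)) (θ≤ j (subst (_≤ j) (+-identityʳ lo) lo≤j) j≤hi)
binomial-doubling-lower {lo = lo} θ≤ (suc q) zero lo≤j _ with () ← subst (_≤ 0) (+-suc lo q) lo≤j
binomial-doubling-lower {r} {θ} {lo} {hi} θ≤ (suc q) (suc j) lo≤j j≤hi = begin
  2 ^ suc q * θ                         ≡⟨ twice (2 ^ q) θ ⟩
  2 ^ q * θ + 2 ^ q * θ                 ≤⟨ +-mono-≤ (binomial-doubling-lower θ≤ q j lo≤j′ (<⇒≤ j≤hi))
                                             (binomial-doubling-lower θ≤ q (suc j) (m≤n⇒m≤1+n lo≤j′) j≤hi) ⟩
  ((q + r) C j) + ((q + r) C suc j)         ≡⟨ nCk+nC[k+1]≡[n+1]C[k+1] (q + r) j ⟩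
  (suc (q + r) C suc j)                   ∎
  where
  open ≤-Reasoning
  lo≤j′ : lo + q ≤ j
  lo≤j′ = s≤s⁻¹ (subst (_≤ suc j) (+-suc lo q) lo≤j)
  twice : ∀ x y → (2 * x) * y ≡ x * y + x * y
  twice = solve-∀

binomial-step : ∀ j s → ((j + suc s) C suc j) * suc j ≡ ((j + suc s) C j) * suc s
binomial-step j s = *-cancelʳ-≡ _ _ (j ! * s !) {{j !* s !≢0}} (begin
  ((j + suc s) C suc j) * suc j * (j ! * s !)  ≡⟨ left ((j + suc s) C suc j) (suc j) (j !) (s !) ⟩
  ((j + suc s) C suc j) * (suc j ! * s !)      ≡⟨ subst (λ z → (z C suc j) * (suc j ! * s !) ≡ z !) (sym (+-suc j s)) (binomial-factorial (suc j) s) ⟩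
  (j + suc s) !                              ≡⟨ sym (binomial-factorial j (suc s)) ⟩
  ((j + suc s) C j) * (j ! * suc s !)          ≡⟨ right ((j + suc s) C j) (suc s) (j !) (s !) ⟩
  ((j + suc s) C j) * suc s * (j ! * s !)      ∎)
  where
  open ≡-Reasoning
  left : ∀ c n x y → c * n * (x * y) ≡ c * ((n * x) * y)
  left = solve-∀
  right : ∀ c n x y → c * (x * (n * y)) ≡ c * n * (x * y)
  right = solve-∀

-- With `h = half r`, the ratio of the two coefficients is `(r - h - i) / (h + i + 1)`, at least
-- `(h - i) / (h + i + 1)`, so the relative loss of one step is at most `(2i + 1) / h`.
binomial-drop : ∀ r i → half r * (r C (half r + i)) ≤ half r * (r C suc (half r + i)) + suc (2 * i) * centralBinom r
binomial-drop r i with suc (half r + i) ≤? r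
-- Here `r ≤ h + i`, which forces `h ≤ 2i + 1`, and the error term alone is large enough.
... | no big = begin
  h * (r C (h + i))                     ≤⟨ *-mono-≤ h≤ (binomial≤central r (h + i)) ⟩
  suc (2 * i) * centralBinom r        ≤⟨ m≤n+m _ (h * (r C suc (h + i))) ⟩
  h * (r C suc (h + i)) + suc (2 * i) * centralBinom r ∎
  where
  open ≤-Reasoning
  h = half r
  h≤i : cohalf r ≤ i
  h≤i = +-cancelˡ-≤ h _ _ (subst (_≤ h + i) (sym (half+cohalf r)) (s≤s⁻¹ (≰⇒> big)))
  h≤ : h ≤ suc (2 * i)
  h≤ = ≤-trans (half≤cohalf r) (≤-trans h≤i (m≤n⇒m≤1+n (m≤m+n i _)))
... | yes small with ≤-total (r C (half r + i)) (r C suc (half r + i))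
... | inj₁ u≤v = ≤-trans (*-monoʳ-≤ (half r) u≤v) (m≤m+n _ _)
... | inj₂ v≤u = begin
  h * u                                       ≡⟨ cong (h *_) (sym (m+[n∸m]≡n v≤u)) ⟩
  h * (v + (u ∸ v))                           ≡⟨ *-distribˡ-+ h v (u ∸ v) ⟩
  h * v + h * (u ∸ v)                         ≤⟨ +-monoʳ-≤ (h * v) gap ⟩
  h * v + suc (2 * i) * centralBinom r        ∎
  where
  open ≤-Reasoning
  h = half r
  u = (r C (h + i))
  v = (r C suc (h + i))
  s = r ∸ suc (h + i)
  r≡ : (h + i) + suc s ≡ r
  r≡ = trans (+-suc (h + i) s) (m+[n∸m]≡n small)
  step : v * suc (h + i) ≡ u * suc s
  step = subst (λ z → (z C suc (h + i)) * suc (h + i) ≡ (z C (h + i)) * suc s) r≡ (binomial-step (h + i) s)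
  h≤ : h ≤ i + suc s
  h≤ = +-cancelˡ-≤ h _ _ (begin
    h + h              ≤⟨ +-monoʳ-≤ h (half≤cohalf r) ⟩
    h + cohalf r       ≡⟨ half+cohalf r ⟩
    r                  ≡⟨ sym r≡ ⟩
    h + i + suc s      ≡⟨ +-assoc h i (suc s) ⟩
    h + (i + suc s)    ∎)
  u-bound : suc (h + i) * u ≤ suc (h + i) * v + suc (2 * i) * u
  u-bound = begin
    suc (h + i) * u                        ≤⟨ *-monoˡ-≤ u (s≤s (+-monoˡ-≤ i h≤)) ⟩
    suc (i + suc s + i) * u                ≡⟨ eq i (suc s) u ⟩
    u * suc s + suc (2 * i) * u            ≡⟨ cong (_+ suc (2 * i) * u) (trans (sym step) (*-comm v _)) ⟩
    suc (h + i) * v + suc (2 * i) * u      ∎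
    where
    eq : ∀ i s u → suc (i + s + i) * u ≡ u * s + suc (2 * i) * u
    eq = solve-∀
  gap : h * (u ∸ v) ≤ suc (2 * i) * centralBinom r
  gap = begin
    h * (u ∸ v)                            ≤⟨ *-monoˡ-≤ (u ∸ v) (m≤n⇒m≤1+n (m≤m+n h i)) ⟩
    suc (h + i) * (u ∸ v)                  ≡⟨ *-distribˡ-∸ (suc (h + i)) u v ⟩
    suc (h + i) * u ∸ suc (h + i) * v      ≤⟨ m≤n+o⇒m∸n≤o (suc (h + i) * u) (suc (h + i) * v) u-bound ⟩
    suc (2 * i) * u                        ≤⟨ *-monoʳ-≤ (suc (2 * i)) (binomial≤central r (h + i)) ⟩
    suc (2 * i) * centralBinom r           ∎

-- The losses of `i` successive steps are odd numbers that add up to `i * i`: the coefficient at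
-- distance `i` above the middle keeps the fraction `1 - i²/h` of the central one.
binomial-near-central : ∀ r i → half r * centralBinom r ≤ half r * (r C (half r + i)) + i * i * centralBinom r
binomial-near-central r zero =
  ≤-reflexive (trans (cong (λ z → half r * (r C z)) (sym (+-identityʳ (half r)))) (sym (+-identityʳ _)))
binomial-near-central r (suc i) = begin
  h * centralBinom r                                       ≤⟨ binomial-near-central r i ⟩
  h * (r C (h + i)) + i * i * centralBinom r                 ≤⟨ +-monoˡ-≤ _ (binomial-drop r i) ⟩
  h * (r C suc (h + i)) + suc (2 * i) * centralBinom r + i * i * centralBinom r ≡⟨ eq (h * (r C suc (h + i))) i (centralBinom r) ⟩
  h * (r C suc (h + i)) + suc i * suc i * centralBinom r     ≡⟨ cong (λ z → h * (r C z) + suc i * suc i * centralBinom r) (sym (+-suc h i)) ⟩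
  h * (r C (h + suc i)) + suc i * suc i * centralBinom r     ∎
  where
  open ≤-Reasoning
  h = half r
  eq : ∀ x i b → x + suc (2 * i) * b + i * i * b ≡ x + suc i * suc i * b
  eq = solve-∀

-- Bernoulli's inequality without division: `(y/K)^d ≤ K/(K + d)`. It is applied with the number of
-- blocks as `K` and the number of blocks outside the closure as `y`.
geometric-decay : ∀ {K y} → suc y ≤ K → ∀ d → (K + d) * y ^ d ≤ K * K ^ d
geometric-decay {K} y<K zero = ≤-reflexive (cong (_* 1) (+-identityʳ K))
geometric-decay {K} {y} y<K (suc d) = begin
  (K + suc d) * (y * y ^ d)     ≡⟨ sym (*-assoc (K + suc d) y _) ⟩
  ((K + suc d) * y) * y ^ d     ≤⟨ *-monoˡ-≤ (y ^ d) lem ⟩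
  (K * (K + d)) * y ^ d         ≡⟨ *-assoc K (K + d) _ ⟩
  K * ((K + d) * y ^ d)         ≤⟨ *-monoʳ-≤ K (geometric-decay y<K d) ⟩
  K * (K * K ^ d)               ∎
  where
  open ≤-Reasoning
  lem : (K + suc d) * y ≤ K * (K + d)
  lem = begin
    (K + suc d) * y         ≡⟨ cong (_* y) (+-suc K d) ⟩
    suc (K + d) * y         ≡⟨⟩
    y + (K + d) * y         ≤⟨ +-monoˡ-≤ _ (≤-trans (n≤1+n y) (≤-trans y<K (m≤m+n K d))) ⟩
    (K + d) + (K + d) * y   ≡⟨ sym (*-suc (K + d) y) ⟩
    (K + d) * suc y         ≤⟨ *-monoʳ-≤ (K + d) y<K ⟩
    (K + d) * K             ≡⟨ *-comm (K + d) K ⟩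
    K * (K + d)             ∎

-- Finite sums over lists

private variable
  A B : Set

∑ : List A → (A → ℕ) → ℕ
∑ []       f = 0
∑ (x ∷ xs) f = f x + ∑ xs f

∑-cong : ∀ (xs : List A) {f g : A → ℕ} → (∀ x → f x ≡ g x) → ∑ xs f ≡ ∑ xs g
∑-cong []       f≡g = refl
∑-cong (x ∷ xs) f≡g = cong₂ _+_ (f≡g x) (∑-cong xs f≡g)

∑-mono-∈ : ∀ (xs : List A) {f g : A → ℕ} → (∀ {x} → x ∈ˡ xs → f x ≤ g x) → ∑ xs f ≤ ∑ xs g
∑-mono-∈ []       f≤g = z≤n
∑-mono-∈ (x ∷ xs) f≤g = +-mono-≤ (f≤g (here refl)) (∑-mono-∈ xs (λ p → f≤g (there p)))

∑-mono : ∀ (xs : List A) {f g : A → ℕ} → (∀ x → f x ≤ g x) → ∑ xs f ≤ ∑ xs g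
∑-mono xs f≤g = ∑-mono-∈ xs (λ {x} _ → f≤g x)

∑-const : ∀ (xs : List A) k → ∑ xs (λ _ → k) ≡ length xs * k
∑-const []       k = refl
∑-const (x ∷ xs) k = cong (k +_) (∑-const xs k)

∑-distrib-+ : ∀ (xs : List A) (f g : A → ℕ) → ∑ xs (λ x → f x + g x) ≡ ∑ xs f + ∑ xs g
∑-distrib-+ []       f g = refl
∑-distrib-+ (x ∷ xs) f g = trans (cong (f x + g x +_) (∑-distrib-+ xs f g)) (interchange (f x) (g x) _ _)
  where
  interchange : ∀ a b c d → a + b + (c + d) ≡ a + c + (b + d)
  interchange = solve-∀

∑-distribˡ-* : ∀ (xs : List A) k (f : A → ℕ) → ∑ xs (λ x → k * f x) ≡ k * ∑ xs f
∑-distribˡ-* []       k f = sym (*-zeroʳ k)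
∑-distribˡ-* (x ∷ xs) k f = trans (cong (k * f x +_) (∑-distribˡ-* xs k f)) (sym (*-distribˡ-+ k (f x) _))

∑-distribʳ-* : ∀ (xs : List A) k (f : A → ℕ) → ∑ xs (λ x → f x * k) ≡ ∑ xs f * k
∑-distribʳ-* xs k f = trans (∑-cong xs (λ x → *-comm (f x) k)) (trans (∑-distribˡ-* xs k f) (*-comm k _))

∑-swap : ∀ (xs : List A) (ys : List B) (f : A → B → ℕ) →
         ∑ xs (λ x → ∑ ys (f x)) ≡ ∑ ys (λ y → ∑ xs (λ x → f x y))
∑-swap []       ys f = sym (trans (∑-const ys 0) (*-zeroʳ (length ys)))
∑-swap (x ∷ xs) ys f = trans (cong (∑ ys (f x) +_) (∑-swap xs ys f)) (sym (∑-distrib-+ ys (f x) _))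

∑-++ : ∀ (xs ys : List A) f → ∑ (xs ++ ys) f ≡ ∑ xs f + ∑ ys f
∑-++ []       ys f = refl
∑-++ (x ∷ xs) ys f = trans (cong (f x +_) (∑-++ xs ys f)) (sym (+-assoc (f x) _ _))

∑-map : ∀ (h : A → B) xs f → ∑ (map h xs) f ≡ ∑ xs (λ x → f (h x))
∑-map h []       f = refl
∑-map h (x ∷ xs) f = cong (f (h x) +_) (∑-map h xs f)

∑-cartesianProduct : ∀ (xs : List A) (ys : List B) f →
  ∑ (cartesianProduct xs ys) f ≡ ∑ xs (λ x → ∑ ys (λ y → f (x , y)))
∑-cartesianProduct []       ys f = refl
∑-cartesianProduct (x ∷ xs) ys f =
  trans (∑-++ (map (x ,_) ys) _ f) (cong₂ _+_ (∑-map (x ,_) ys f) (∑-cartesianProduct xs ys f))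

⟦_⟧ : Bool → ℕ
⟦ false ⟧ = 0
⟦ true  ⟧ = 1

∑-exclusive≤1 : ∀ {xs : List A} → Unique xs → (φ : A → Bool) →
  (∀ x y → φ x ≡ true → φ y ≡ true → x ≡ y) → ∑ xs (λ x → ⟦ φ x ⟧) ≤ 1
∑-exclusive≤1 [] φ excl = z≤n
∑-exclusive≤1 {xs = x ∷ xs} (x∉ ∷ uniq) φ excl with φ x in eq
... | false = ∑-exclusive≤1 uniq φ excl
... | true  = s≤s (≤-reflexive (vanish xs x∉))
  where
  vanish : ∀ ys → All (x ≢_) ys → ∑ ys (λ y → ⟦ φ y ⟧) ≡ 0
  vanish []       []         = refl
  vanish (y ∷ ys) (x≢y ∷ x∉) with φ y in eq′
  ... | false = vanish ys x∉
  ... | true  = ⊥-elim (x≢y (excl x y eq eq′))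

-- Subsets

#+#∁ : ∀ {n} (S : Subset n) → # S + # ∁ S ≡ n
#+#∁ []            = refl
#+#∁ (inside ∷ S)  = cong suc (#+#∁ S)
#+#∁ (outside ∷ S) = trans (+-suc (# S) _) (cong suc (#+#∁ S))

#∁≡0⇒lookup : ∀ {n} (S : Subset n) → # ∁ S ≡ 0 → ∀ x → lookup S x ≡ inside
#∁≡0⇒lookup (inside ∷ S) eq zero    = refl
#∁≡0⇒lookup (inside ∷ S) eq (suc x) = #∁≡0⇒lookup S eq x

#≡0⇒lookup : ∀ {n} (S : Subset n) → # S ≡ 0 → ∀ x → lookup S x ≡ outside
#≡0⇒lookup (outside ∷ S) eq zero    = refl
#≡0⇒lookup (outside ∷ S) eq (suc x) = #≡0⇒lookup S eq x

#∁≡0⇒⊇ : ∀ {n} (S T : Subset n) → # ∁ S ≡ 0 → T ⊆ S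
#∁≡0⇒⊇ S T eq {x} _ = lookup⇒[]= x S (#∁≡0⇒lookup S eq x)

#≡0⇒⊆ : ∀ {n} (S T : Subset n) → # S ≡ 0 → S ⊆ T
#≡0⇒⊆ S T eq {x} x∈S with () ← trans (sym ([]=⇒lookup x∈S)) (#≡0⇒lookup S eq x)

#-removeAt : ∀ {n} (S : Subset (suc n)) x → lookup S x ≡ outside → # removeAt S x ≡ # S
#-removeAt (outside ∷ S)           zero    _  = refl
#-removeAt (inside  ∷ S@(_ ∷ _)) (suc x) eq = cong suc (#-removeAt S x eq)
#-removeAt (outside ∷ S@(_ ∷ _)) (suc x) eq = #-removeAt S x eq

#∁-removeAt : ∀ {n} (S : Subset (suc n)) x → lookup S x ≡ outside → suc (# ∁ (removeAt S x)) ≡ # ∁ S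
#∁-removeAt (outside ∷ S)           zero    _  = refl
#∁-removeAt (inside  ∷ S@(_ ∷ _)) (suc x) eq = #∁-removeAt S x eq
#∁-removeAt (outside ∷ S@(_ ∷ _)) (suc x) eq = cong suc (#∁-removeAt S x eq)

removeAt-⊆⁻ : ∀ {n} (S T : Subset (suc n)) x → lookup S x ≡ outside → removeAt S x ⊆ removeAt T x → S ⊆ T
removeAt-⊆⁻ S T x Sx S⊆T {y} y∈S with x Fin.≟ y
... | yes refl with () ← trans (sym ([]=⇒lookup y∈S)) Sx
... | no x≢y = lookup⇒[]= y T (trans (sym (removeAt-punchOut T x≢y)) ([]=⇒lookup
      (S⊆T (lookup⇒[]= _ (removeAt S x) (trans (removeAt-punchOut S x≢y) ([]=⇒lookup y∈S))))))

removeAt-⊆⁺ : ∀ {n} (S T : Subset (suc n)) x → S ⊆ T → removeAt S x ⊆ removeAt T x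
removeAt-⊆⁺ (s ∷ S)         (t ∷ T)         zero    S⊆T = drop-∷-⊆ S⊆T
removeAt-⊆⁺ (s ∷ S@(_ ∷ _)) (t ∷ T@(_ ∷ _)) (suc x) S⊆T = ∷-⊆⁺ S⊆T (removeAt-⊆⁺ S T x (drop-∷-⊆ S⊆T))
  where
  ∷-⊆⁺ : ∀ {n m s t} {S T : Subset n} {S′ T′ : Subset m} → s ∷ S ⊆ t ∷ T → S′ ⊆ T′ → s ∷ S′ ⊆ t ∷ T′
  ∷-⊆⁺ {s = outside} _ S⊆T = out⊆ S⊆T
  ∷-⊆⁺ {s = inside} {t = inside} _ S⊆T = s⊆s S⊆T
  ∷-⊆⁺ {s = inside} {t = outside} p _ with () ← p {zero} hereᵛ

⊆-lookup-outside : ∀ {n} (S T : Subset n) x → S ⊆ T → lookup T x ≡ outside → lookup S x ≡ outside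
⊆-lookup-outside S T x S⊆T Tx with lookup S x in Sx
... | outside = refl
... | inside with () ← trans (sym ([]=⇒lookup (S⊆T (lookup⇒[]= x S Sx)))) Tx

-- Maximal chains

-- A maximal chain of the cube, as the order in which a descent from the full set deletes elements;
-- after each deletion the remaining elements are renumbered.
Chain : ℕ → Set
Chain zero    = ⊤
Chain (suc n) = Fin (suc n) × Chain n

chains : ∀ n → List (Chain n)
chains zero    = tt ∷ []
chains (suc n) = cartesianProduct (allFin (suc n)) (chains n)

-- Every descent starts at the full set. Any other set is met exactly when the first deleted element
-- lies outside it and the rest of the descent, on the remaining elements, meets it.
passes : ∀ {n} → Chain n → Subset n → Bool
passes {zero}  _        S = true
passes {suc n} (x , ch) S = (# ∁ S ≡ᵇ 0) ∨ (not (lookup S x) ∧ passes ch (removeAt S x))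

passes-comparable : ∀ {n} (ch : Chain n) S T → passes ch S ≡ true → passes ch T ≡ true → S ⊆ T ⊎ T ⊆ S
passes-comparable {zero} _ [] [] _ _ = inj₁ λ ()
passes-comparable {suc n} (x , ch) S T p q with # ∁ S in eqS | # ∁ T in eqT
... | zero  | _     = inj₂ (#∁≡0⇒⊇ S T eqS)
... | suc _ | zero  = inj₁ (#∁≡0⇒⊇ T S eqT)
... | suc _ | suc _ with lookup S x in Sx | lookup T x in Tx
... | outside | outside with passes-comparable ch (removeAt S x) (removeAt T x) p q
... | inj₁ S⊆T = inj₁ (removeAt-⊆⁻ S T x Sx S⊆T)
... | inj₂ T⊆S = inj₂ (removeAt-⊆⁻ T S x Tx T⊆S)

length-chains : ∀ n → ∑ (chains n) (λ _ → 1) ≡ n !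
length-chains zero    = refl
length-chains (suc n) = begin
  ∑ (chains (suc n)) (λ _ → 1)                             ≡⟨ ∑-cartesianProduct (allFin (suc n)) (chains n) _ ⟩
  ∑ (allFin (suc n)) (λ _ → ∑ (chains n) (λ _ → 1))        ≡⟨ ∑-cong (allFin (suc n)) (λ _ → length-chains n) ⟩
  ∑ (allFin (suc n)) (λ _ → n !)                           ≡⟨ ∑-const (allFin (suc n)) (n !) ⟩
  length (allFin (suc n)) * n !                            ≡⟨ cong (_* n !) (length-tabulate {n = suc n} (λ i → i)) ⟩
  suc n !                                                  ∎
  where
  open ≡-Reasoning

∑-outside : ∀ {n} (S : Subset n) → ∑ (allFin n) (λ x → ⟦ not (lookup S x) ⟧) ≡ # ∁ S
∑-outside S = go S (λ x → x) (λ x → ⟦ not (lookup S x) ⟧) (λ _ → refl)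
  where
  go : ∀ {n A} (S : Subset n) (g : Fin n → A) f → (∀ x → f (g x) ≡ ⟦ not (lookup S x) ⟧) → ∑ (tabulate g) f ≡ # ∁ S
  go []            g f eq = refl
  go (inside ∷ S)  g f eq = cong₂ _+_ (eq zero) (go S (λ x → g (suc x)) f (λ x → eq (suc x)))
  go (outside ∷ S) g f eq = cong₂ _+_ (eq zero) (go S (λ x → g (suc x)) f (λ x → eq (suc x)))

∑-outside-const : ∀ {n} (S : Subset n) k → ∑ (allFin n) (λ x → ⟦ not (lookup S x) ⟧ * k) ≡ # ∁ S * k
∑-outside-const {n} S k = trans (∑-distribʳ-* (allFin n) k _) (cong (_* k) (∑-outside S))

-- A descent through `S` deletes the complement first and then `S`, each in any order.
∑-passes : ∀ {n} (S : Subset n) → ∑ (chains n) (λ ch → ⟦ passes ch S ⟧) ≡ (# S) ! * (# ∁ S) !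
∑-passes {zero}  [] = refl
∑-passes {suc n} S with # ∁ S in eq
... | zero  = begin
  ∑ (chains (suc n)) (λ _ → 1)   ≡⟨ length-chains (suc n) ⟩
  suc n !                        ≡⟨ cong _! (trans (sym (#+#∁ S)) (trans (cong (# S +_) eq) (+-identityʳ _))) ⟩
  (# S) !                        ≡⟨ sym (*-identityʳ _) ⟩
  (# S) ! * 1                    ∎
  where open ≡-Reasoning
... | suc k = begin
  _   ≡⟨ ∑-cartesianProduct (allFin (suc n)) (chains n) _ ⟩
  ∑ (allFin (suc n)) (λ x → ∑ (chains n) (λ ch → ⟦ not (lookup S x) ∧ passes ch (removeAt S x) ⟧))
      ≡⟨ ∑-cong (allFin (suc n)) link ⟩
  ∑ (allFin (suc n)) (λ x → ⟦ not (lookup S x) ⟧ * ((# S) ! * k !))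
      ≡⟨ ∑-outside-const S _ ⟩
  # ∁ S * ((# S) ! * k !)     ≡⟨ cong (_* ((# S) ! * k !)) eq ⟩
  suc k * ((# S) ! * k !)     ≡⟨ swap (suc k) ((# S) !) (k !) ⟩
  (# S) ! * (suc k * k !)     ∎
  where
  open ≡-Reasoning
  swap : ∀ x y z → x * (y * z) ≡ y * (x * z)
  swap = solve-∀
  link : ∀ x → ∑ (chains n) (λ ch → ⟦ not (lookup S x) ∧ passes ch (removeAt S x) ⟧)
             ≡ ⟦ not (lookup S x) ⟧ * ((# S) ! * k !)
  link x with lookup S x in Sx
  ... | inside  = trans (∑-const (chains n) 0) (*-zeroʳ (length (chains n)))
  ... | outside = trans (∑-passes (removeAt S x)) (trans
      (cong₂ (λ a b → a ! * b !) (#-removeAt S x Sx) (suc-injective (trans (#∁-removeAt S x Sx) eq)))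
      (sym (*-identityˡ _)))

-- A descent through both sets deletes the complement of `T`, then the `e` elements of `T` outside
-- `S`, then `S`, each in any order. Measuring `e` by complements suits the recursion: an element
-- outside `T` is outside `S` too, so its deletion leaves `e` unchanged.
∑-passes₂ : ∀ {n} (S T : Subset n) e → S ⊆ T → # ∁ S ≡ e + # ∁ T →
  ∑ (chains n) (λ ch → ⟦ passes ch S ∧ passes ch T ⟧) ≤ (# S) ! * (e ! * (# ∁ T) !)
∑-passes₂ {zero} [] [] e S⊆T eq = ≤-trans (1≤n! e) (≤-reflexive (one (e !)))
  where
  one : ∀ x → x ≡ 1 * (x * 1)
  one = solve-∀
∑-passes₂ {suc n} S T e S⊆T eq with # ∁ T in eqT
... | zero = begin
  ∑ (chains (suc n)) (λ ch → ⟦ passes ch S ∧ true ⟧)   ≡⟨ ∑-cong (chains (suc n)) (λ ch → cong ⟦_⟧ (∧-identityʳ (passes ch S))) ⟩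
  ∑ (chains (suc n)) (λ ch → ⟦ passes ch S ⟧)          ≡⟨ ∑-passes S ⟩
  (# S) ! * (# ∁ S) !                                  ≡⟨ cong (λ z → (# S) ! * z) (trans (cong _! (trans eq (+-identityʳ e))) (sym (*-identityʳ (e !)))) ⟩
  (# S) ! * (e ! * 1)                                  ∎
  where open ≤-Reasoning
... | suc k with # ∁ S in eqS
... | zero with () ← trans eq (+-suc e k)
... | suc j = begin
  _   ≡⟨ ∑-cartesianProduct (allFin (suc n)) (chains n) _ ⟩
  ∑ (allFin (suc n)) (λ x → ∑ (chains n) (λ ch → ⟦ (not (lookup S x) ∧ passes ch (removeAt S x)) ∧ (not (lookup T x) ∧ passes ch (removeAt T x)) ⟧))
      ≤⟨ ∑-mono (allFin (suc n)) link ⟩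
  ∑ (allFin (suc n)) (λ x → ⟦ not (lookup T x) ⟧ * ((# S) ! * (e ! * k !)))
      ≡⟨ ∑-outside-const T _ ⟩
  # ∁ T * ((# S) ! * (e ! * k !))     ≡⟨ cong (_* ((# S) ! * (e ! * k !))) eqT ⟩
  suc k * ((# S) ! * (e ! * k !))     ≡⟨ swap (suc k) ((# S) !) (e !) (k !) ⟩
  (# S) ! * (e ! * (suc k * k !))     ∎
  where
  open ≤-Reasoning
  swap : ∀ x y z w → x * (y * (z * w)) ≡ y * (z * (x * w))
  swap = solve-∀
  link : ∀ x → ∑ (chains n) (λ ch → ⟦ (not (lookup S x) ∧ passes ch (removeAt S x)) ∧ (not (lookup T x) ∧ passes ch (removeAt T x)) ⟧)
             ≤ ⟦ not (lookup T x) ⟧ * ((# S) ! * (e ! * k !))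
  link x with lookup T x in Tx
  ... | inside  = ≤-reflexive (trans (∑-cong (chains n) (λ ch → cong ⟦_⟧ (∧-zeroʳ (not (lookup S x) ∧ passes ch (removeAt S x)))))
                    (trans (∑-const (chains n) 0) (*-zeroʳ (length (chains n)))))
  ... | outside rewrite ⊆-lookup-outside S T x S⊆T Tx = ≤-trans
      (∑-passes₂ (removeAt S x) (removeAt T x) e (removeAt-⊆⁺ S T x S⊆T)
        (suc-injective (trans (#∁-removeAt S x Sx) (trans eqS (trans eq (trans (cong (e +_) (sym (trans (#∁-removeAt T x Tx) eqT))) (+-suc e _)))))))
      (≤-reflexive (trans (cong₂ (λ a b → a ! * (e ! * b !)) (#-removeAt S x Sx) (suc-injective (trans (#∁-removeAt T x Tx) eqT)))
        (sym (*-identityˡ _))))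
    where
    Sx = ⊆-lookup-outside S T x S⊆T Tx

-- Lists of subsets

length-cartesianProduct : ∀ (xs : List A) (ys : List B) → length (cartesianProduct xs ys) ≡ length xs * length ys
length-cartesianProduct []       ys = refl
length-cartesianProduct (x ∷ xs) ys =
  trans (length-++ (map (x ,_) ys)) (cong₂ _+_ (length-map (x ,_) ys) (length-cartesianProduct xs ys))

unique-⊆⇒length≤ : ∀ {xs ys : List A} → Unique xs → (∀ {x} → x ∈ˡ xs → x ∈ˡ ys) → length xs ≤ length ys
unique-⊆⇒length≤ [] _ = z≤n
unique-⊆⇒length≤ {xs = x ∷ xs} (x∉ ∷ uniq) xs⊆ys with ∈-∃++ (xs⊆ys (here refl))
... | as , bs , refl = ≤-trans (s≤s (unique-⊆⇒length≤ uniq xs⊆as++bs)) (≤-reflexive (sym (length-++-sucʳ as x bs)))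
  where
  xs⊆as++bs : ∀ {y} → y ∈ˡ xs → y ∈ˡ as ++ bs
  xs⊆as++bs y∈xs with ∈-++⁻ as (xs⊆ys (there y∈xs))
  ... | inj₁ y∈as         = ∈-++⁺ˡ y∈as
  ... | inj₂ (here refl)  = ⊥-elim (All.lookup x∉ y∈xs refl)
  ... | inj₂ (there y∈bs) = ∈-++⁺ʳ as y∈bs

subsets : ∀ n → List (Subset n)
subsets zero    = [] ∷ []
subsets (suc n) = map (inside ∷_) (subsets n) ++ map (outside ∷_) (subsets n)

length-subsets : ∀ n → length (subsets n) ≡ 2 ^ n
length-subsets zero    = refl
length-subsets (suc n) = trans (length-++ (map (inside ∷_) (subsets n)))
  (cong₂ _+_ (trans (length-map _ (subsets n)) (length-subsets n))
    (trans (length-map _ (subsets n)) (trans (length-subsets n) (sym (+-identityʳ _)))))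

∈-subsets : ∀ {n} (S : Subset n) → S ∈ˡ subsets n
∈-subsets []            = here refl
∈-subsets (inside ∷ S)  = ∈-++⁺ˡ (∈-map⁺ _ (∈-subsets S))
∈-subsets {suc n} (outside ∷ S) = ∈-++⁺ʳ (map (inside ∷_) (subsets n)) (∈-map⁺ _ (∈-subsets S))

∷-injectiveʳ : ∀ {n s} {S T : Subset n} → s ∷ S ≡ s ∷ T → S ≡ T
∷-injectiveʳ refl = refl

subsets-unique : ∀ n → Unique (subsets n)
subsets-unique zero    = [] ∷ []
subsets-unique (suc n) = Unique.++⁺ (Unique.map⁺ ∷-injectiveʳ (subsets-unique n)) (Unique.map⁺ ∷-injectiveʳ (subsets-unique n)) disjoint
  where
  disjoint : ∀ {S} → ¬ (S ∈ˡ map (inside ∷_) (subsets n) × S ∈ˡ map (outside ∷_) (subsets n))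
  disjoint (p , q) with ∈-map⁻ _ p | ∈-map⁻ _ q
  ... | _ , _ , refl | _ , _ , ()

⊆∧#≡⇒≡ : ∀ {n} (S T : Subset n) → S ⊆ T → # S ≡ # T → S ≡ T
⊆∧#≡⇒≡ [] [] _ _ = refl
⊆∧#≡⇒≡ (inside ∷ S)  (inside ∷ T)  S⊆T eq = cong (inside ∷_) (⊆∧#≡⇒≡ S T (drop-∷-⊆ S⊆T) (suc-injective eq))
⊆∧#≡⇒≡ (inside ∷ S)  (outside ∷ T) S⊆T eq with () ← S⊆T {zero} hereᵛ
⊆∧#≡⇒≡ (outside ∷ S) (inside ∷ T)  S⊆T eq = ⊥-elim (1+n≰n (≤-trans (≤-reflexive (sym eq)) (p⊆q⇒∣p∣≤∣q∣ (drop-∷-⊆ S⊆T))))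
⊆∧#≡⇒≡ (outside ∷ S) (outside ∷ T) S⊆T eq = cong (outside ∷_) (⊆∧#≡⇒≡ S T (drop-∷-⊆ S⊆T) eq)

-- Chains meeting a convex closure

chainCount : ∀ {n} → Subset n → ℕ
chainCount S = (# S) ! * (# ∁ S) !

chainCount-min : ∀ {n} (S : Subset n) → minFactorials n ≤ chainCount S
chainCount-min S = minFactorials-min {# S} {# ∁ S} (#+#∁ S)

-- The empty and the full set lie together on all maximal chains, so for this pair a bound with the
-- factor `1/n` fails for large `n`.
Proper : ∀ {n} → Subset n → Set
Proper S = (1 ≤ # S) × (1 ≤ # ∁ S)

-- Let `e` be the number of elements of `T` outside `S`. Then `n = a + e + b` is at most
-- `(e + b) + (a + e)`. By `factorial-product` the first summand turns `e ! * b !` into at most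
-- `(e + b) !`, which yields `chainCount S`, and the second turns `a ! * e !` into at most
-- `(a + e) !`, which yields `chainCount T`.
jointCount-⊆ : ∀ {n} (S T : Subset n) → Proper S → Proper T → S ≢ T → S ⊆ T →
  n * ∑ (chains n) (λ ch → ⟦ passes ch S ∧ passes ch T ⟧) ≤ chainCount S + chainCount T
jointCount-⊆ {n} S T (1≤a , _) (_ , 1≤b) S≢T S⊆T = begin
  n * ∑ (chains n) (λ ch → ⟦ passes ch S ∧ passes ch T ⟧)  ≤⟨ *-monoʳ-≤ n (∑-passes₂ S T e S⊆T ∁S≡) ⟩
  n * (a ! * (e ! * b !))                             ≡⟨ cong (_* (a ! * (e ! * b !))) (sym n≡) ⟩
  (a + (e + b)) * (a ! * (e ! * b !))                 ≤⟨ m≤m+n _ _ ⟩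
  _ + e * (a ! * (e ! * b !))                         ≡⟨ split a e b (a !) (e !) (b !) ⟩
  a ! * ((e + b) * (e ! * b !)) + (a + e) * (a ! * e !) * b !
    ≤⟨ +-mono-≤ (*-monoʳ-≤ (a !) (factorial-product 1≤e 1≤b)) (*-monoˡ-≤ (b !) (factorial-product 1≤a 1≤e)) ⟩
  a ! * (e + b) ! + (a + e) ! * b !                   ≡⟨ cong₂ (λ x y → a ! * x ! + y ! * b !) (sym ∁S≡) (sym T≡) ⟩
  chainCount S + chainCount T                         ∎
  where
  open ≤-Reasoning
  a = # S
  b = # ∁ T
  e = # ∁ S ∸ # ∁ T
  ∁S≡ : # ∁ S ≡ e + b
  ∁S≡ = sym (m∸n+n≡m (p⊆q⇒∣p∣≤∣q∣ (p⊆q⇒∁p⊇∁q S⊆T)))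
  n≡ : a + (e + b) ≡ n
  n≡ = trans (cong (a +_) (sym ∁S≡)) (#+#∁ S)
  T≡ : # T ≡ a + e
  T≡ = +-cancelʳ-≡ b _ _ (trans (#+#∁ T) (trans (sym n≡) (sym (+-assoc a e b))))
  1≤e : 1 ≤ e
  1≤e with e in eq
  ... | suc _ = s≤s z≤n
  ... | zero  = ⊥-elim (S≢T (⊆∧#≡⇒≡ S T S⊆T (sym (trans T≡ (trans (cong (a +_) eq) (+-identityʳ a))))))
  split : ∀ a e b x y z → (a + (e + b)) * (x * (y * z)) + e * (x * (y * z)) ≡ x * ((e + b) * (y * z)) + (a + e) * (x * y) * z
  split = solve-∀

jointCount : ∀ {n} (S T : Subset n) → Proper S → Proper T → S ≢ T →
  n * ∑ (chains n) (λ ch → ⟦ passes ch S ∧ passes ch T ⟧) ≤ chainCount S + chainCount T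
jointCount {n} S T pS pT S≢T with S ⊆? T | T ⊆? S
... | yes S⊆T | _       = jointCount-⊆ S T pS pT S≢T S⊆T
... | no _    | yes T⊆S = begin
  n * ∑ (chains n) (λ ch → ⟦ passes ch S ∧ passes ch T ⟧)
    ≡⟨ cong (n *_) (∑-cong (chains n) (λ ch → cong ⟦_⟧ (∧-comm (passes ch S) (passes ch T)))) ⟩
  n * ∑ (chains n) (λ ch → ⟦ passes ch T ∧ passes ch S ⟧)
    ≤⟨ jointCount-⊆ T S pT pS (≢-sym S≢T) T⊆S ⟩
  chainCount T + chainCount S
    ≡⟨ +-comm (chainCount T) (chainCount S) ⟩
  chainCount S + chainCount T ∎
  where open ≤-Reasoning
... | no S⊈T  | no T⊈S = ≤-trans (≤-reflexive (trans (cong (n *_) vanish) (*-zeroʳ n))) z≤n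
  where
  vanish-at : ∀ ch → ⟦ passes ch S ∧ passes ch T ⟧ ≡ 0
  vanish-at ch with passes ch S in p | passes ch T in q
  ... | false | _     = refl
  ... | true  | false = refl
  ... | true  | true with passes-comparable ch S T p q
  ... | inj₁ S⊆T = ⊥-elim (S⊈T S⊆T)
  ... | inj₂ T⊆S = ⊥-elim (T⊈S T⊆S)
  vanish : ∑ (chains n) (λ ch → ⟦ passes ch S ∧ passes ch T ⟧) ≡ 0
  vanish = trans (∑-cong (chains n) vanish-at) (trans (∑-const (chains n) 0) (*-zeroʳ (length (chains n))))

meets : ∀ {n} → Chain n → List (Subset n) → Bool
meets ch G = any (passes ch) G

meets⇒∈ : ∀ {n} (ch : Chain n) G → meets ch G ≡ true → ∃[ S ] (S ∈ˡ G × passes ch S ≡ true)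
meets⇒∈ ch (S ∷ G) m with passes ch S in p
... | true  = S , here refl , p
... | false with T , T∈G , q ← meets⇒∈ ch G m = T , there T∈G , q

pairHits : ∀ {n} → Chain n → List (Subset n) → ℕ
pairHits ch []      = 0
pairHits ch (S ∷ G) = ∑ G (λ T → ⟦ passes ch S ∧ passes ch T ⟧) + pairHits ch G

-- If `h` entries of `G` lie on the chain, `pairHits` is `h(h - 1)/2`, and `h ≤ 1 + h(h - 1)/2`; for
-- `h = 0` both sides vanish.
bonferroni : ∀ {n} (ch : Chain n) G → ∑ G (λ S → ⟦ passes ch S ⟧) ≤ ⟦ meets ch G ⟧ + pairHits ch G
bonferroni ch []      = z≤n
bonferroni ch (S ∷ G) with passes ch S
... | false = ≤-trans (bonferroni ch G) (+-monoʳ-≤ ⟦ meets ch G ⟧ (m≤n+m (pairHits ch G) _))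
... | true  = s≤s (≤-trans (bonferroni ch G) (+-monoˡ-≤ (pairHits ch G) (meets≤hits G)))
  where
  meets≤hits : ∀ G → ⟦ meets ch G ⟧ ≤ ∑ G (λ T → ⟦ true ∧ passes ch T ⟧)
  meets≤hits []      = z≤n
  meets≤hits (T ∷ G) with passes ch T
  ... | true  = s≤s z≤n
  ... | false = meets≤hits G

-- Each member belongs to `length G - 1` pairs, and `jointCount` charges every pair to the chain
-- counts of its two members; `length G - 1` is rounded up to `length G`.
∑-pairHits : ∀ {n} (G : List (Subset n)) → Unique G → (∀ {S} → S ∈ˡ G → Proper S) →
  n * ∑ (chains n) (λ ch → pairHits ch G) ≤ length G * ∑ G chainCount
∑-pairHits {n} [] _ _ = ≤-reflexive (trans (cong (n *_) (trans (∑-const (chains n) 0) (*-zeroʳ (length (chains n))))) (*-zeroʳ n))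
∑-pairHits {n} (S ∷ G) (S∉G ∷ uniq) proper = begin
  n * ∑ (chains n) (λ ch → pairHits ch (S ∷ G))
    ≡⟨ cong (n *_) (trans (∑-distrib-+ (chains n) _ _) (cong (_+ ∑ (chains n) (λ ch → pairHits ch G)) (∑-swap (chains n) G _))) ⟩
  n * (∑ G joint + ∑ (chains n) (λ ch → pairHits ch G))
    ≡⟨ *-distribˡ-+ n _ _ ⟩
  n * ∑ G joint + n * ∑ (chains n) (λ ch → pairHits ch G)
    ≡⟨ cong (_+ n * ∑ (chains n) (λ ch → pairHits ch G)) (sym (∑-distribˡ-* G n joint)) ⟩
  ∑ G (λ T → n * joint T) + n * ∑ (chains n) (λ ch → pairHits ch G)
    ≤⟨ +-mono-≤ (∑-mono-∈ G (λ {T} T∈G → jointCount S T (proper (here refl)) (proper (there T∈G)) (All.lookup S∉G T∈G)))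
                (∑-pairHits G uniq (λ p → proper (there p))) ⟩
  ∑ G (λ T → chainCount S + chainCount T) + length G * ∑ G chainCount
    ≡⟨ cong (_+ length G * ∑ G chainCount) (trans (∑-distrib-+ G _ _) (cong (_+ ∑ G chainCount) (∑-const G (chainCount S)))) ⟩
  length G * chainCount S + ∑ G chainCount + length G * ∑ G chainCount
    ≤⟨ m≤m+n _ (chainCount S) ⟩
  _ ≡⟨ collect (length G) (chainCount S) (∑ G chainCount) ⟩
  suc (length G) * (chainCount S + ∑ G chainCount) ∎
  where
  open ≤-Reasoning
  joint : Subset n → ℕ
  joint T = ∑ (chains n) (λ ch → ⟦ passes ch S ∧ passes ch T ⟧)
  collect : ∀ l x y → l * x + y + l * y + x ≡ suc l * (x + y)
  collect = solve-∀

-- The pair term is controlled by the sum `s` of the actual chain counts, which may exceed `c * μ`.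
-- So `s` is collected on one side as `(n ∸ c) * s` before it is replaced by its lower bound
-- `c * μ`.
meets-lower : ∀ {n} (G : List (Subset n)) → length G ≤ n → Unique G → (∀ {S} → S ∈ˡ G → Proper S) →
  n * (length G * minFactorials n) ≤ n * ∑ (chains n) (λ ch → ⟦ meets ch G ⟧) + length G * (length G * minFactorials n)
meets-lower {n} G c≤n uniq proper = begin
  n * (c * μ)              ≡⟨ cong (_* (c * μ)) (sym (m∸n+n≡m c≤n)) ⟩
  ((n ∸ c) + c) * (c * μ)  ≡⟨ *-distribʳ-+ (c * μ) (n ∸ c) c ⟩
  (n ∸ c) * (c * μ) + c * (c * μ) ≤⟨ +-monoˡ-≤ (c * (c * μ)) (*-monoʳ-≤ (n ∸ c) cμ≤s) ⟩
  (n ∸ c) * s + c * (c * μ) ≤⟨ +-monoˡ-≤ (c * (c * μ)) drop ⟩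
  n * hits + c * (c * μ)    ∎
  where
  open ≤-Reasoning
  c = length G
  μ = minFactorials n
  s = ∑ G chainCount
  hits = ∑ (chains n) (λ ch → ⟦ meets ch G ⟧)
  cμ≤s : c * μ ≤ s
  cμ≤s = subst (_≤ s) (∑-const G μ) (∑-mono G chainCount-min)
  s≤ : s ≤ hits + ∑ (chains n) (λ ch → pairHits ch G)
  s≤ = begin
    s                                                          ≡⟨ ∑-cong G (λ S → sym (∑-passes S)) ⟩
    ∑ G (λ S → ∑ (chains n) (λ ch → ⟦ passes ch S ⟧))          ≡⟨ ∑-swap G (chains n) _ ⟩
    ∑ (chains n) (λ ch → ∑ G (λ S → ⟦ passes ch S ⟧))          ≤⟨ ∑-mono (chains n) (λ ch → bonferroni ch G) ⟩
    ∑ (chains n) (λ ch → ⟦ meets ch G ⟧ + pairHits ch G)       ≡⟨ ∑-distrib-+ (chains n) _ _ ⟩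
    hits + ∑ (chains n) (λ ch → pairHits ch G)                 ∎
  ns≤ : n * s ≤ n * hits + c * s
  ns≤ = begin
    n * s                                                  ≤⟨ *-monoʳ-≤ n s≤ ⟩
    n * (hits + ∑ (chains n) (λ ch → pairHits ch G))       ≡⟨ *-distribˡ-+ n hits _ ⟩
    n * hits + n * ∑ (chains n) (λ ch → pairHits ch G)     ≤⟨ +-monoʳ-≤ (n * hits) (∑-pairHits G uniq proper) ⟩
    n * hits + c * s                                       ∎
  drop : (n ∸ c) * s ≤ n * hits
  drop = begin
    (n ∸ c) * s      ≡⟨ *-distribʳ-∸ s n c ⟩
    n * s ∸ c * s    ≤⟨ m≤n+o⇒m∸n≤o (n * s) (c * s) (≤-trans ns≤ (≤-reflexive (+-comm (n * hits) (c * s)))) ⟩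
    n * hits         ∎

-- No chain meets two of the families, so the hits add up to at most `n !`, which is
-- `centralBinom n * μ`; then `μ` cancels.
packing-bound : ∀ {n t c} (G : Fin t → List (Subset n)) → c ≤ n →
  (∀ i → Unique (G i)) → (∀ i → length (G i) ≡ c) → (∀ i {S} → S ∈ˡ G i → Proper S) →
  (∀ i j {S T} → S ∈ˡ G i → T ∈ˡ G j → S ⊆ T → i ≡ j) →
  n * (t * c) ≤ n * centralBinom n + c * (t * c)
packing-bound {n} {t} {c} G c≤n uniq len proper unrelated = *-cancelʳ-≤ _ _ μ {{minFactorials≢0 n}} (begin
  n * (t * c) * μ                                    ≡⟨ eq₁ n t c μ ⟩
  t * (n * (c * μ))                                  ≡⟨ sym (trans (∑-const (allFin t) _) (cong (_* (n * (c * μ))) (length-tabulate {n = t} (λ i → i)))) ⟩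
  ∑ (allFin t) (λ i → n * (c * μ))                   ≤⟨ ∑-mono (allFin t) each ⟩
  ∑ (allFin t) (λ i → n * hits i + c * (c * μ))      ≡⟨ ∑-distrib-+ (allFin t) _ _ ⟩
  ∑ (allFin t) (λ i → n * hits i) + ∑ (allFin t) (λ i → c * (c * μ))
    ≡⟨ cong₂ _+_ (∑-distribˡ-* (allFin t) n hits) (trans (∑-const (allFin t) _) (cong (_* (c * (c * μ))) (length-tabulate {n = t} (λ i → i)))) ⟩
  n * ∑ (allFin t) hits + t * (c * (c * μ))          ≤⟨ +-monoˡ-≤ _ (*-monoʳ-≤ n total) ⟩
  n * n ! + t * (c * (c * μ))                        ≡⟨ cong (λ z → n * z + t * (c * (c * μ))) (sym (centralBinom-factorial n)) ⟩
  n * (centralBinom n * μ) + t * (c * (c * μ))       ≡⟨ eq₂ n (centralBinom n) t c μ ⟩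
  (n * centralBinom n + c * (t * c)) * μ             ∎)
  where
  open ≤-Reasoning
  μ = minFactorials n
  eq₁ : ∀ n t c μ → n * (t * c) * μ ≡ t * (n * (c * μ))
  eq₁ = solve-∀
  eq₂ : ∀ n b t c μ → n * (b * μ) + t * (c * (c * μ)) ≡ (n * b + c * (t * c)) * μ
  eq₂ = solve-∀
  hits : Fin t → ℕ
  hits i = ∑ (chains n) (λ ch → ⟦ meets ch (G i) ⟧)
  each : ∀ i → n * (c * μ) ≤ n * hits i + c * (c * μ)
  each i = subst (λ c → n * (c * μ) ≤ n * hits i + c * (c * μ)) (len i)
    (meets-lower (G i) (subst (_≤ n) (sym (len i)) c≤n) (uniq i) (proper i))
  exclusive : ∀ ch i j → meets ch (G i) ≡ true → meets ch (G j) ≡ true → i ≡ j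
  exclusive ch i j p q with meets⇒∈ ch (G i) p | meets⇒∈ ch (G j) q
  ... | S , S∈ , pS | T , T∈ , pT with passes-comparable ch S T pS pT
  ... | inj₁ S⊆T = unrelated i j S∈ T∈ S⊆T
  ... | inj₂ T⊆S = sym (unrelated j i T∈ S∈ T⊆S)
  total : ∑ (allFin t) hits ≤ n !
  total = begin
    ∑ (allFin t) hits                                             ≡⟨ ∑-swap (allFin t) (chains n) _ ⟩
    ∑ (chains n) (λ ch → ∑ (allFin t) (λ i → ⟦ meets ch (G i) ⟧)) ≤⟨ ∑-mono (chains n) (λ ch → ∑-exclusive≤1 (Unique.allFin⁺ t) _ (exclusive ch)) ⟩
    ∑ (chains n) (λ _ → 1)                                        ≡⟨ length-chains n ⟩
    n !                                                           ∎

-- Upper bound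

module _ (P : FinPoset) {k} (f : Fin (size P) → Subset k) where

  inConvexClosure? : ∀ S → Dec (InConvexClosure P k f S)
  inConvexClosure? S = Fin.any? (λ a → Fin.any? (λ b → (f a ⊆? S) ×-dec (S ⊆? f b)))

  closure : List (Subset k)
  closure = filter inConvexClosure? (subsets k)

  closure-unique : Unique closure
  closure-unique = Unique.filter⁺ inConvexClosure? (subsets-unique k)

  ∈-closure⁻ : ∀ {S} → S ∈ˡ closure → InConvexClosure P k f S
  ∈-closure⁻ p = proj₂ (∈-filter⁻ inConvexClosure? {xs = subsets k} p)

  ∈-closure⁺ : ∀ {S} → InConvexClosure P k f S → S ∈ˡ closure
  ∈-closure⁺ {S} p = ∈-filter⁺ inConvexClosure? (∈-subsets S) p

  hasSize-closure : HasSize (InConvexClosure P k f) (length closure)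
  hasSize-closure = closure , closure-unique , (λ S → mk⇔ ∈-closure⁻ ∈-closure⁺) , refl

take-⊆ : ∀ k (xs : List A) {x} → x ∈ˡ take k xs → x ∈ˡ xs
take-⊆ (suc k) (y ∷ xs) (here eq) = here eq
take-⊆ (suc k) (y ∷ xs) (there p) = there (take-⊆ k xs p)

copies-bound : ∀ P {n t c} (F : Fin t → Fin (size P) → Subset n) → (∀ i → StrongEmbedding P n (F i)) →
  PairwiseUnrelated P n t F → (∀ c′ → CAchievable P c′ → c ≤ c′) → c ≤ n →
  n * (t * c) ≤ n * centralBinom n + c * (t * c)
copies-bound P {n} {zero}        F emb unrel min c≤n = ≤-trans (≤-reflexive (*-zeroʳ n)) z≤n
-- The closure of a single copy may contain the empty or the full set; here `c ≤ n ≤ centralBinom n`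
-- replaces the chain count.
copies-bound P {n} {suc zero}{c} F emb unrel min c≤n =
  ≤-trans (*-monoʳ-≤ n (≤-trans (≤-reflexive (+-identityʳ c)) (≤-trans c≤n (n≤centralBinom n)))) (m≤m+n _ _)
copies-bound P {n} {t@(suc (suc _))} {c} F emb unrel min c≤n =
  packing-bound G c≤n (λ i → Unique.take⁺ c (closure-unique P (F i))) len proper unrelated
  where
  G : Fin t → List (Subset n)
  -- Minimality of `c` guarantees that this many members exist; keeping no more gives an error term
  -- in terms of `c` alone.
  G i = take c (closure P (F i))
  len : ∀ i → length (G i) ≡ c
  len i = trans (length-take c (closure P (F i))) (m≤n⇒m⊓n≡m (min _ (n , F i , emb i , hasSize-closure P (F i))))
  G⊆ : ∀ i {S} → S ∈ˡ G i → InConvexClosure P n (F i) S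
  G⊆ i {S} p = ∈-closure⁻ P (F i) (take-⊆ c (closure P (F i)) p)
  other : (i : Fin t) → ∃[ j ] i ≢ j
  other zero    = suc zero , λ ()
  other (suc i) = zero , λ ()
  proper : ∀ i {S} → S ∈ˡ G i → Proper S
  proper i {S} p with G⊆ i p | other i
  -- An empty `S` would make `F i a` empty and thus contained in `F j a`; dually, a full `S` would
  -- make `F i b` full.
  ... | a , b , Fa⊆S , S⊆Fb | j , i≢j =
    n≢0⇒n>0 (λ eq → proj₁ (unrel i j i≢j a a) (⊆-trans Fa⊆S (#≡0⇒⊆ S (F j a) eq))) ,
    n≢0⇒n>0 (λ eq → proj₂ (unrel i j i≢j b b) (⊆-trans (#∁≡0⇒⊇ S (F j b) eq) S⊆Fb))
  unrelated : ∀ i j {S T} → S ∈ˡ G i → T ∈ˡ G j → S ⊆ T → i ≡ j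
  unrelated i j p q S⊆T with i Fin.≟ j
  ... | yes i≡j = i≡j
  ... | no i≢j with G⊆ i p | G⊆ j q
  ... | a , _ , Fa⊆S , _ | _ , b , _ , T⊆Fb = ⊥-elim (proj₁ (unrel i j i≢j a b) (⊆-trans Fa⊆S (⊆-trans S⊆T T⊆Fb)))

module _ (P : FinPoset) {n t} (F : Fin t → Fin (size P) → Subset n) where

  copyUnion : List (Subset n)
  copyUnion = map (λ (i , a) → F i a) (cartesianProduct (allFin t) (allFin (size P)))

  length-copyUnion : length copyUnion ≡ t * size P
  length-copyUnion = trans (length-map _ (cartesianProduct (allFin t) (allFin (size P)))) (trans (length-cartesianProduct (allFin t) (allFin (size P)))
    (cong₂ _*_ (length-tabulate {n = t} (λ i → i)) (length-tabulate {n = size P} (λ i → i))))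

  ∈-copyUnion⁺ : ∀ {S} → InUnion P n t F S → S ∈ˡ copyUnion
  ∈-copyUnion⁺ (i , a , refl) = ∈-map⁺ _ (∈-cartesianProduct⁺ (∈-allFin i) (∈-allFin a))

  ∈-copyUnion⁻ : ∀ {S} → S ∈ˡ copyUnion → InUnion P n t F S
  ∈-copyUnion⁻ p with (i , a) , _ , refl ← ∈-map⁻ _ p = i , a , refl

  union-size≤ : ∀ {m} → HasSize (InUnion P n t F) m → m ≤ t * size P
  union-size≤ (xs , uniq , char , refl) = subst (length xs ≤_) length-copyUnion
    (unique-⊆⇒length≤ uniq (λ {S} p → ∈-copyUnion⁺ (Equivalence.to (char S) p)))

  union-size : (∀ i → StrongEmbedding P n (F i)) → PairwiseUnrelated P n t F → HasSize (InUnion P n t F) (t * size P)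
  union-size emb unrel = copyUnion , Unique.map⁺ inj (Unique.cartesianProduct⁺ (Unique.allFin⁺ t) (Unique.allFin⁺ (size P))) ,
    (λ S → mk⇔ ∈-copyUnion⁻ ∈-copyUnion⁺) , length-copyUnion
    where
    inj : ∀ {x y : Fin t × Fin (size P)} → F (proj₁ x) (proj₂ x) ≡ F (proj₁ y) (proj₂ y) → x ≡ y
    inj {i , a} {j , b} eq with i Fin.≟ j
    ... | yes refl = cong (i ,_) (proj₁ (emb i) a b eq)
    ... | no i≢j   = ⊥-elim (proj₁ (unrel i j i≢j a b) (⊆-reflexive eq))

-- Reduction of the dimension of an embedding

-- Comparison with a reference embedding by plain inclusion, free of strictness, so that it passes
-- directly to the products with a constant set from which the copies are built.
SameOrder : ∀ {p m n} → (Fin p → Subset m) → (Fin p → Subset n) → Set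
SameOrder f g = (∀ a b → f a ⊆ f b → g a ⊆ g b) × (∀ a b → g a ⊆ g b → f a ⊆ f b)

strongEmbedding-resp : ∀ P {m n f g} → SameOrder f g → StrongEmbedding P m f → StrongEmbedding P n g
strongEmbedding-resp P {f = f} {g} (f⇒g , g⇒f) (inj , ord) =
  (λ a b eq → inj a b (g≡⇒f≡ a b eq)) ,
  λ a b → (λ a<b → f⇒g a b (proj₁ (proj₁ (ord a b) a<b)) , λ eq → proj₂ (proj₁ (ord a b) a<b) (g≡⇒f≡ a b eq)) ,
          (λ (ga⊆gb , ga≢gb) → proj₂ (ord a b) (g⇒f a b ga⊆gb , λ eq → ga≢gb (⊆-antisym (f⇒g a b (⊆-reflexive eq)) (f⇒g b a (⊆-reflexive (sym eq))))))
  where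
  g≡⇒f≡ : ∀ a b → g a ≡ g b → f a ≡ f b
  g≡⇒f≡ a b eq = ⊆-antisym (g⇒f a b (⊆-reflexive eq)) (g⇒f b a (⊆-reflexive (sym eq)))

-- The dimension k of an optimal embedding is not bounded a priori, but the threshold N must be computed
-- from the size of P alone. Identifying coordinates that belong to the same sets f a brings k down to 2 ^ p.
module Merge {p k} (f : Fin p → Subset k) where

  bit : Bool → Fin 2
  bit false = zero
  bit true  = suc zero

  bit-injective : ∀ x y → bit x ≡ bit y → x ≡ y
  bit-injective false false _ = refl
  bit-injective true  true  _ = refl

  column : Fin k → Fin (2 ^ p)
  column i = funToFin (λ a → bit (lookup (f a) i))

  column-∈ : ∀ {i j} a → column i ≡ column j → i ∈ f a → j ∈ f a
  column-∈ {i} {j} a eq i∈ = lookup⇒[]= j (f a) (trans (sym (bit-injective _ _ bits≡)) ([]=⇒lookup i∈))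
    where
    bits≡ : bit (lookup (f a) i) ≡ bit (lookup (f a) j)
    bits≡ = trans (sym (Fin.finToFun-funToFin (λ a → bit (lookup (f a) i)) a))
      (trans (cong (λ z → finToFun z a) eq) (Fin.finToFun-funToFin (λ a → bit (lookup (f a) j)) a))

  occurs? : ∀ S y → Dec (∃[ i ] (column i ≡ y × i ∈ S))
  occurs? S y = Fin.any? (λ i → (column i Fin.≟ y) ×-dec (i ∈? S))

  merge : Subset k → Subset (2 ^ p)
  merge S = Vec.tabulate (λ y → does (occurs? S y))

  ∈-merge⁺ : ∀ {S i} → i ∈ S → column i ∈ merge S
  ∈-merge⁺ {S} {i} i∈S = lookup⇒[]= (column i) (merge S)
    (trans (lookup∘tabulate _ (column i)) (dec-true (occurs? S (column i)) (i , refl , i∈S)))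

  ∈-merge⁻ : ∀ {S y} → y ∈ merge S → ∃[ i ] (column i ≡ y × i ∈ S)
  ∈-merge⁻ {S} {y} y∈ with occurs? S y | trans (sym (lookup∘tabulate (λ y → does (occurs? S y)) y)) ([]=⇒lookup y∈)
  ... | yes w | _ = w

  merged : Fin p → Subset (2 ^ p)
  merged a = merge (f a)

  ∈-merged⁻ : ∀ {i} a → column i ∈ merged a → i ∈ f a
  ∈-merged⁻ a y∈ with j , eq , j∈ ← ∈-merge⁻ y∈ = column-∈ a eq j∈

  merged-sameOrder : SameOrder f merged
  merged-sameOrder = (λ a b fa⊆fb y∈ → mono fa⊆fb y∈) ,
    (λ a b ma⊆mb i∈ → ∈-merged⁻ b (ma⊆mb (∈-merge⁺ i∈)))
    where
    mono : ∀ {S T} → S ⊆ T → merge S ⊆ merge T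
    mono S⊆T y∈ with i , refl , i∈ ← ∈-merge⁻ y∈ = ∈-merge⁺ (S⊆T i∈)

  unmerge : Subset (2 ^ p) → Subset k
  unmerge S = Vec.tabulate (λ i → lookup S (column i))

  ∈-unmerge⁺ : ∀ {S i} → column i ∈ S → i ∈ unmerge S
  ∈-unmerge⁺ {S} {i} y∈ = lookup⇒[]= i (unmerge S) (trans (lookup∘tabulate _ i) ([]=⇒lookup y∈))

  ∈-unmerge⁻ : ∀ {S i} → i ∈ unmerge S → column i ∈ S
  ∈-unmerge⁻ {S} {i} i∈ = lookup⇒[]= (column i) S (trans (sym (lookup∘tabulate _ i)) ([]=⇒lookup i∈))

-- `merge` takes images and `unmerge` preimages under `column`. Each `f a` is a union of fibres of
-- `column`, so the preimage of a member of the merged closure lies in the closure of `f`, and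
-- `merge` maps it back to that member.
closure-merged : ∀ P {k} (f : Fin (size P) → Subset k) → length (closure P (Merge.merged f)) ≤ length (closure P f)
closure-merged P f = subst (length (closure P merged) ≤_) (length-map merge (closure P f))
  (unique-⊆⇒length≤ (closure-unique P merged) lifted)
  where
  open Merge f
  lifted : ∀ {S} → S ∈ˡ closure P merged → S ∈ˡ map merge (closure P f)
  lifted {S} S∈ with a , b , a⊆S , S⊆b ← ∈-closure⁻ P merged S∈ =
    subst (_∈ˡ map merge (closure P f)) merge-unmerge (∈-map⁺ merge (∈-closure⁺ P f
      (a , b , (λ i∈ → ∈-unmerge⁺ (a⊆S (∈-merge⁺ i∈))) , (λ i∈ → ∈-merged⁻ b (S⊆b (∈-unmerge⁻ i∈))))))
    where
    back : merge (unmerge S) ⊆ S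
    back y∈ with i , refl , i∈ ← ∈-merge⁻ y∈ = ∈-unmerge⁻ i∈
    forth : S ⊆ merge (unmerge S)
    -- A point outside the image of `column` would be lost; `S` has none, being contained in
    -- `merged b`.
    forth y∈ with i , refl , _ ← ∈-merge⁻ (S⊆b y∈) = ∈-merge⁺ (∈-unmerge⁺ y∈)
    merge-unmerge : merge (unmerge S) ≡ S
    merge-unmerge = ⊆-antisym back forth

-- Packing copies near the middle level

⧺-⊆⁺ : ∀ {m n} {S T : Subset m} {A B : Subset n} → S ⊆ T → A ⊆ B → S ⧺ A ⊆ T ⧺ B
⧺-⊆⁺ {S = []}          {[]}          S⊆T A⊆B = A⊆B
⧺-⊆⁺ {S = inside  ∷ S} {inside  ∷ T} S⊆T A⊆B = s⊆s (⧺-⊆⁺ (drop-∷-⊆ S⊆T) A⊆B)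
⧺-⊆⁺ {S = inside  ∷ S} {outside ∷ T} S⊆T A⊆B with () ← S⊆T {zero} hereᵛ
⧺-⊆⁺ {S = outside ∷ S} {t ∷ T}       S⊆T A⊆B = out⊆ (⧺-⊆⁺ (drop-∷-⊆ S⊆T) A⊆B)

⧺-⊆⁻ : ∀ {m n} (S T : Subset m) {A B : Subset n} → S ⧺ A ⊆ T ⧺ B → S ⊆ T × A ⊆ B
⧺-⊆⁻ []            []            A⊆B = ⊆-refl {x = []} , A⊆B
⧺-⊆⁻ (inside  ∷ S) (outside ∷ T) ST  with () ← ST {zero} hereᵛ
⧺-⊆⁻ (inside  ∷ S) (inside  ∷ T) ST  with S⊆T , A⊆B ← ⧺-⊆⁻ S T (drop-∷-⊆ ST) = s⊆s S⊆T , A⊆B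
⧺-⊆⁻ (outside ∷ S) (t ∷ T)       ST  with S⊆T , A⊆B ← ⧺-⊆⁻ S T (drop-∷-⊆ ST) = out⊆ S⊆T , A⊆B

#-⧺ : ∀ {m n} (S : Subset m) (A : Subset n) → # (S ⧺ A) ≡ # S + # A
#-⧺ []            A = refl
#-⧺ (inside ∷ S)  A = cong suc (#-⧺ S A)
#-⧺ (outside ∷ S) A = #-⧺ S A

level : ∀ n → ℕ → List (Subset n)
level zero    zero    = [] ∷ []
level zero    (suc m) = []
level (suc n) zero    = map (outside ∷_) (level n zero)
level (suc n) (suc m) = map (inside ∷_) (level n m) ++ map (outside ∷_) (level n (suc m))

length-level : ∀ n m → length (level n m) ≡ n C m
length-level zero    zero    = refl
length-level zero    (suc m) = refl
length-level (suc n) zero    = trans (length-map _ (level n zero)) (length-level n zero)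
length-level (suc n) (suc m) = trans (length-++ (map (inside ∷_) (level n m))) (trans
  (cong₂ _+_ (trans (length-map _ (level n m)) (length-level n m)) (trans (length-map _ (level n (suc m))) (length-level n (suc m))))
  (nCk+nC[k+1]≡[n+1]C[k+1] n m))

#-level : ∀ n m → All (λ A → # A ≡ m) (level n m)
#-level zero    zero    = refl ∷ []
#-level zero    (suc m) = []
#-level (suc n) zero    = All.map⁺ (#-level n zero)
#-level (suc n) (suc m) = All.++⁺ (All.map⁺ (All.map (cong suc) (#-level n m))) (All.map⁺ (#-level n (suc m)))

∷-incomparable : ∀ {n s} {A B : Subset n} → Incomparable A B → Incomparable (s ∷ A) (s ∷ B)
∷-incomparable (A⊈B , B⊈A) = (λ A⊆B → A⊈B (drop-∷-⊆ A⊆B)) , (λ B⊆A → B⊈A (drop-∷-⊆ B⊆A))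

level-antichain : ∀ n m → AllPairs Incomparable (level n m)
level-antichain zero    zero    = [] ∷ []
level-antichain zero    (suc m) = []
level-antichain (suc n) zero    = AllPairs.map⁺ (AllPairs.map ∷-incomparable (level-antichain n zero))
level-antichain (suc n) (suc m) = AllPairs.++⁺
  (AllPairs.map⁺ (AllPairs.map ∷-incomparable (level-antichain n m)))
  (AllPairs.map⁺ (AllPairs.map ∷-incomparable (level-antichain n (suc m))))
  (All.map⁺ (All.map (λ #A → All.map⁺ (All.map (cross #A) (#-level n (suc m)))) (#-level n m)))
  where
  cross : ∀ {A B : Subset n} → # A ≡ m → # B ≡ suc m → Incomparable (inside ∷ A) (outside ∷ B)
  cross #A #B = (λ A⊆B → case₁ (A⊆B {zero} hereᵛ)) ,
    λ B⊆A → 1+n≰n (subst₂ _≤_ #B #A (p⊆q⇒∣p∣≤∣q∣ (drop-∷-⊆ B⊆A)))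
    where
    case₁ : ∀ {B : Subset n} → ¬ (zero ∈ outside ∷ B)
    case₁ ()

Unrelated : ∀ {p n} → (Fin p → Subset n) → (Fin p → Subset n) → Set
Unrelated F F′ = ∀ a b → Incomparable (F a) (F′ b)

-- A band of the previous round spans `bandWidth K d + 1` levels, and one such slot is reserved for
-- each cardinality from 0 to `K` of an outsider. This is needed on both sides of the level `mid`,
-- and the sets placed on the `K` new coordinates add up to `K` to the size.
bandWidth : ℕ → ℕ → ℕ
bandWidth K zero    = 0
bandWidth K (suc d) = suc (suc K * suc (bandWidth K d) + suc K * suc (bandWidth K d)) + K

module Tiling (P : FinPoset) {K} (f : Fin (size P) → Subset K) where

  p = size P

  Copies : ℕ → Set
  Copies n = List (Fin p → Subset n)

  Below : Subset K → Set
  Below T = ∃[ c ] T ⊆ f c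

  below? : ∀ T → Dec (Below T)
  below? T = Fin.any? (λ c → T ⊆? f c)

  outsiders : List (Subset K)
  outsiders = filter (λ T → ¬? (inConvexClosure? P f T)) (subsets K)

  outsiders-unique : Unique outsiders
  outsiders-unique = Unique.filter⁺ _ (subsets-unique K)

  ∈-outsiders⁻ : ∀ {T} → T ∈ˡ outsiders → ¬ InConvexClosure P K f T
  ∈-outsiders⁻ T∈ = proj₂ (∈-filter⁻ _ {xs = subsets K} T∈)

  length-filter-¬ : ∀ {A : Set} {Q : A → Set} (Q? : ∀ x → Dec (Q x)) xs →
    length (filter Q? xs) + length (filter (λ x → ¬? (Q? x)) xs) ≡ length xs
  length-filter-¬ Q? [] = refl
  length-filter-¬ Q? (x ∷ xs) with Q? x
  ... | yes _ = cong suc (length-filter-¬ Q? xs)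
  ... | no _  = trans (+-suc _ _) (cong suc (length-filter-¬ Q? xs))

  closure+outsiders : length (closure P f) + length outsiders ≡ 2 ^ K
  closure+outsiders = trans (length-filter-¬ (inConvexClosure? P f) (subsets K)) (length-subsets K)

  width : ℕ → ℕ
  width = bandWidth K

  dim : ℕ → ℕ → ℕ
  dim zero    r = r
  dim (suc d) r = K + dim d r

  mid : ℕ → ℕ → ℕ
  mid d l = l + suc K * suc (width d)

  base : ℕ → ℕ → Subset K → ℕ
  base d l T = if does (below? T) then suc (mid d l) else l

  -- The levels [start , start + width] for the parts attached to different outsiders are disjoint,
  -- larger outsiders being given lower levels, and they avoid the level mid on the side prescribed by Below.
  start : ℕ → ℕ → Subset K → ℕ
  start d l T = base d l T + (K ∸ # T) * suc (width d)

  attach : ∀ {n} → Subset K → (Fin p → Subset n) → Fin p → Subset (K + n)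
  attach T F a = T ⧺ F a

  translate : ∀ {n} → Subset n → Fin p → Subset (K + n)
  translate A a = f a ⧺ A

  -- The argument `l` is the lower end of the band that the copies may occupy. When the rounds are
  -- used up, the remaining blocks stay empty; they make up the uncovered fraction.
  family : ∀ d r → ℕ → Copies (dim d r)
  part : ∀ d r → ℕ → Subset K → Copies (K + dim d r)
  family zero    r l = []
  family (suc d) r l = map translate (level (dim d r) (mid d l)) ++ concat (map (part d r l) outsiders)
  part d r l T = map (attach T) (family d r (start d l T))

  open ≤-Reasoning hiding (start)

  below-⊆ : ∀ {T T′} → T ⊆ T′ → Below T′ → Below T
  below-⊆ T⊆T′ (c , T′⊆fc) = c , ⊆-trans T⊆T′ T′⊆fc

  base-below : ∀ d l T → Below T → base d l T ≡ suc (mid d l)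
  base-below d l T b rewrite dec-true (below? T) b = refl

  base-¬below : ∀ d l T → ¬ Below T → base d l T ≡ l
  base-¬below d l T ¬b with below? T
  ... | yes b = ⊥-elim (¬b b)
  ... | no _  = refl

  l≤base : ∀ d l T → l ≤ base d l T
  l≤base d l T with does (below? T)
  ... | true  = m≤n⇒m≤1+n (m≤m+n l _)
  ... | false = ≤-refl

  base≤ : ∀ d l T → base d l T ≤ suc (mid d l)
  base≤ d l T with does (below? T)
  ... | true  = ≤-refl
  ... | false = m≤n⇒m≤1+n (m≤m+n l _)

  base-mono : ∀ d l {T T′} → T ⊆ T′ → base d l T′ ≤ base d l T
  base-mono d l {T} {T′} T⊆T′ with below? T′
  ... | no _  = l≤base d l T
  ... | yes b = ≤-reflexive (sym (base-below d l T (below-⊆ T⊆T′ b)))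

  start-top : ∀ d l T → suc (start d l T + width d) ≤ base d l T + suc K * suc (width d)
  start-top d l T = begin
    suc (start d l T + width d)           ≡⟨ eq (base d l T) (K ∸ # T) (width d) ⟩
    base d l T + suc (K ∸ # T) * suc (width d)
      ≤⟨ +-monoʳ-≤ (base d l T) (*-monoˡ-≤ (suc (width d)) (s≤s (m∸n≤m K (# T)))) ⟩
    base d l T + suc K * suc (width d)    ∎
    where
    eq : ∀ b k w → suc (b + k * suc w + w) ≡ b + suc k * suc w
    eq = solve-∀

  start+width≤ : ∀ d l T → start d l T + width d + K ≤ l + width (suc d)
  start+width≤ d l T = begin
    start d l T + width d + K             ≤⟨ +-monoˡ-≤ K (<⇒≤ (≤-trans (start-top d l T) (+-monoˡ-≤ _ (base≤ d l T)))) ⟩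
    suc (l + V) + V + K                   ≡⟨ eq l V K ⟩
    l + width (suc d)                     ∎
    where
    V = suc K * suc (width d)
    eq : ∀ l V K → suc (l + V) + V + K ≡ l + (suc (V + V) + K)
    eq = solve-∀

  -- Both summands of `start` favour the smaller set: `Below` is closed downwards, so `base` cannot
  -- increase with `T`, and a strictly larger cardinality lowers `K ∸ # T` by at least one whole
  -- slot.
  start-separated : ∀ d l {T T′} → T ⊆ T′ → T ≢ T′ → start d l T′ + width d < start d l T
  start-separated d l {T} {T′} T⊆T′ T≢T′ = begin
    suc (start d l T′ + width d)                    ≡⟨ eq (base d l T′) (K ∸ # T′) (width d) ⟩
    base d l T′ + suc (K ∸ # T′) * suc (width d)
      ≤⟨ +-mono-≤ (base-mono d l T⊆T′) (*-monoˡ-≤ (suc (width d)) (∸-monoʳ-< #T<#T′ (∣p∣≤n T′))) ⟩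
    base d l T + (K ∸ # T) * suc (width d)          ∎
    where
    eq : ∀ b k w → suc (b + k * suc w + w) ≡ b + suc k * suc w
    eq = solve-∀
    #T<#T′ : # T < # T′
    #T<#T′ = ≤∧≢⇒< (p⊆q⇒∣p∣≤∣q∣ T⊆T′) (λ eq → T≢T′ (⊆∧#≡⇒≡ T T′ T⊆T′ eq))

  InBand : ∀ {n} → ℕ → ℕ → (Fin p → Subset n) → Set
  InBand lo w F = ∀ a → lo ≤ # F a × # F a ≤ lo + w

  all-parts : ∀ d r l {Q : (Fin p → Subset (K + dim d r)) → Set} →
    (∀ {T} → T ∈ˡ outsiders → All (λ F → Q (attach T F)) (family d r (start d l T))) →
    All Q (concat (map (part d r l) outsiders))
  all-parts d r l q = All.concat⁺ (All.map⁺ (All.tabulate (λ T∈ → All.map⁺ (q T∈))))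

  family-inBand : ∀ d r l → All (InBand l (width d)) (family d r l)
  family-inBand zero    r l = []
  family-inBand (suc d) r l = All.++⁺
    (All.map⁺ (All.map translated (#-level (dim d r) (mid d l))))
    (all-parts d r l (λ {T} _ → All.map (attached T) (family-inBand d r (start d l T))))
    where
    V = suc K * suc (width d)
    translated : ∀ {A} → # A ≡ mid d l → InBand l (width (suc d)) (translate A)
    translated {A} #A a rewrite #-⧺ (f a) A | #A =
      ≤-trans (m≤m+n l V) (m≤n+m (mid d l) (# f a)) ,
      (begin
        # f a + (l + V)               ≤⟨ +-monoˡ-≤ (l + V) (∣p∣≤n (f a)) ⟩
        K + (l + V)                   ≤⟨ m≤m+n _ (suc V) ⟩
        K + (l + V) + suc V           ≡⟨ eq K l V ⟩
        l + (suc (V + V) + K)         ∎)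
      where
      eq : ∀ K l V → K + (l + V) + suc V ≡ l + (suc (V + V) + K)
      eq = solve-∀
    attached : ∀ T {F} → InBand (start d l T) (width d) F → InBand l (width (suc d)) (attach T F)
    attached T {F} band a rewrite #-⧺ T (F a) =
      ≤-trans (≤-trans (l≤base d l T) (m≤m+n _ _)) (≤-trans (proj₁ (band a)) (m≤n+m _ (# T))) ,
      (begin
        # T + # F a                       ≤⟨ +-mono-≤ (∣p∣≤n T) (proj₂ (band a)) ⟩
        K + (start d l T + width d)       ≡⟨ +-comm K _ ⟩
        start d l T + width d + K         ≤⟨ start+width≤ d l T ⟩
        l + width (suc d)                 ∎)

  family-sameOrder : ∀ d r l → All (SameOrder f) (family d r l)
  family-sameOrder zero    r l = []
  family-sameOrder (suc d) r l = All.++⁺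
    (All.map⁺ (All.universal translated (level (dim d r) (mid d l))))
    (all-parts d r l (λ {T} _ → All.map (attached T) (family-sameOrder d r (start d l T))))
    where
    translated : ∀ A → SameOrder f (translate A)
    translated A = (λ a b fa⊆fb → ⧺-⊆⁺ {S = f a} {f b} fa⊆fb (⊆-refl {x = A})) , (λ a b p → proj₁ (⧺-⊆⁻ (f a) (f b) p))
    attached : ∀ T {F} → SameOrder f F → SameOrder f (attach T F)
    attached T (f⇒F , F⇒f) = (λ a b fa⊆fb → ⧺-⊆⁺ (⊆-refl {x = T}) (f⇒F a b fa⊆fb)) ,
      (λ a b p → F⇒f a b (proj₂ (⧺-⊆⁻ T T p)))

  translate-unrelated : ∀ {n} {A B : Subset n} → Incomparable A B → Unrelated (translate A) (translate B)
  translate-unrelated (A⊈B , B⊈A) a b =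
    (λ p → A⊈B (proj₂ (⧺-⊆⁻ (f a) (f b) p))) , (λ p → B⊈A (proj₂ (⧺-⊆⁻ (f b) (f a) p)))

  attach-unrelated : ∀ {n} T {F F′ : Fin p → Subset n} → Unrelated F F′ → Unrelated (attach T F) (attach T F′)
  attach-unrelated T unrel a b =
    (λ p → proj₁ (unrel a b) (proj₂ (⧺-⊆⁻ T T p))) , (λ p → proj₂ (unrel a b) (proj₂ (⧺-⊆⁻ T T p)))

  attach-attach : ∀ d l {n T T′} {F F′ : Fin p → Subset n} → T ≢ T′ →
    InBand (start d l T) (width d) F → InBand (start d l T′) (width d) F′ → Unrelated (attach T F) (attach T′ F′)
  attach-attach d l {T = T} {T′} {F} {F′} T≢T′ band band′ a b =
    ⊈ {F = F} {F′} T≢T′ band band′ a b , ⊈ {F = F′} {F} (≢-sym T≢T′) band′ band b a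
    where
    ⊈ : ∀ {n T T′} {F F′ : Fin p → Subset n} → T ≢ T′ →
      InBand (start d l T) (width d) F → InBand (start d l T′) (width d) F′ → ∀ a b → ¬ (T ⧺ F a ⊆ T′ ⧺ F′ b)
    ⊈ {T = T} {T′} {F} {F′} T≢T′ band band′ a b p with T⊆T′ , Fa⊆F′b ← ⧺-⊆⁻ T T′ p = 1+n≰n (begin
      suc (start d l T′ + width d)   ≤⟨ start-separated d l T⊆T′ T≢T′ ⟩
      start d l T                    ≤⟨ proj₁ (band a) ⟩
      # F a                          ≤⟨ p⊆q⇒∣p∣≤∣q∣ Fa⊆F′b ⟩
      # F′ b                         ≤⟨ proj₂ (band′ b) ⟩
      start d l T′ + width d         ∎)

  -- If `f a ⊆ T`, then `T` lies below no `f c`, since it would otherwise be in the closure, and its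
  -- band ends under `mid`. If `T ⊆ f a`, its band begins above `mid`. Either way the sizes of the
  -- second components contradict their inclusion.
  translate-attach : ∀ d l {n T} {A : Subset n} {F : Fin p → Subset n} → ¬ InConvexClosure P K f T →
    # A ≡ mid d l → InBand (start d l T) (width d) F → Unrelated (translate A) (attach T F)
  translate-attach d l {n} {T} {A} {F} T∉ #A band a b = ⊈ , ⊉
    where
    ⊈ : ¬ (f a ⧺ A ⊆ T ⧺ F b)
    ⊈ p with fa⊆T , A⊆Fb ← ⧺-⊆⁻ (f a) T p = 1+n≰n (begin
      suc (mid d l)                             ≡⟨ cong suc (sym #A) ⟩
      suc (# A)                                 ≤⟨ s≤s (≤-trans (p⊆q⇒∣p∣≤∣q∣ A⊆Fb) (proj₂ (band b))) ⟩
      suc (start d l T + width d)               ≤⟨ start-top d l T ⟩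
      base d l T + suc K * suc (width d)        ≡⟨ cong (_+ suc K * suc (width d)) (base-¬below d l T (λ (c , T⊆fc) → T∉ (a , c , fa⊆T , T⊆fc))) ⟩
      mid d l                                   ∎)
    ⊉ : ¬ (T ⧺ F b ⊆ f a ⧺ A)
    ⊉ p with T⊆fa , Fb⊆A ← ⧺-⊆⁻ T (f a) p = 1+n≰n (begin
      suc (mid d l)      ≡⟨ sym (base-below d l T (a , T⊆fa)) ⟩
      base d l T         ≤⟨ m≤m+n _ _ ⟩
      start d l T        ≤⟨ proj₁ (band b) ⟩
      # F b              ≤⟨ p⊆q⇒∣p∣≤∣q∣ Fb⊆A ⟩
      # A                ≡⟨ #A ⟩
      mid d l            ∎)

  family-unrelated : ∀ d r l → AllPairs Unrelated (family d r l)
  family-unrelated zero    r l = []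
  family-unrelated (suc d) r l = AllPairs.++⁺
    (AllPairs.map⁺ (AllPairs.map translate-unrelated (level-antichain (dim d r) (mid d l))))
    (AllPairs.concat⁺
      (All.map⁺ (All.universal (λ T → AllPairs.map⁺ (AllPairs.map (attach-unrelated T) (family-unrelated d r (start d l T)))) outsiders))
      (AllPairs.map⁺ (AllPairs.map (λ {T} {T′} T≢T′ →
        All.map⁺ (All.map (λ band → All.map⁺ (All.map (attach-attach d l T≢T′ band) (family-inBand d r (start d l T′)))) (family-inBand d r (start d l T))))
        outsiders-unique)))
    (All.map⁺ (All.map (λ #A → all-parts d r l (λ {T} T∈ →
      All.map (translate-attach d l (∈-outsiders⁻ T∈) #A) (family-inBand d r (start d l T)))) (#-level (dim d r) (mid d l))))

  dim≡ : ∀ d r → dim d r ≡ d * K + r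
  dim≡ zero    r = refl
  dim≡ (suc d) r = trans (cong (K +_) (dim≡ d r)) (sym (+-assoc K (d * K) r))

  length-parts : ∀ d r l → length (concat (map (part d r l) outsiders)) ≡ ∑ outsiders (λ T → length (family d r (start d l T)))
  length-parts d r l = go outsiders
    where
    go : ∀ Ts → length (concat (map (part d r l) Ts)) ≡ ∑ Ts (λ T → length (family d r (start d l T)))
    go []       = refl
    go (T ∷ Ts) = trans (length-++ (part d r l T)) (cong₂ _+_ (length-map _ (family d r (start d l T))) (go Ts))

  -- Each of the `2 ^ K` blocks is assigned the same quota. One translate accounts for one unit in
  -- each closure block, which gives the factor `length (closure P f)`; each outsider block is
  -- settled by induction, and the uncovered part is multiplied by `length outsiders` per round. The
  -- term `d * K` is what the use of Pascal's rule takes from the window.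
  family-size : ∀ {r θ lo hi} → (∀ j → lo ≤ j → j ≤ hi → θ ≤ r C j) →
    ∀ d l → lo + d * K ≤ l → l + width d ≤ hi →
    (2 ^ K) ^ d * θ ≤ length (closure P f) * length (family d r l) + length outsiders ^ d * θ
  family-size {θ = θ} θ≤ zero l _ _ = m≤n+m (1 * θ) (length (closure P f) * 0)
  family-size {r} {θ} {lo} {hi} θ≤ (suc d) l lo≤ ≤hi = begin
    Q * Q ^ d * θ                                       ≡⟨ trans (*-assoc Q (Q ^ d) θ) (cong (_* (Q ^ d * θ)) (sym closure+outsiders)) ⟩
    (c + y) * (Q ^ d * θ)                               ≡⟨ *-distribʳ-+ (Q ^ d * θ) c y ⟩
    c * (Q ^ d * θ) + y * (Q ^ d * θ)                   ≤⟨ +-mono-≤ (*-monoʳ-≤ c middle) parts ⟩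
    c * length (level (dim d r) (mid d l)) + (c * s + y * (y ^ d * θ))
      ≡⟨ eq c (length (level (dim d r) (mid d l))) s y (y ^ d) θ ⟩
    c * (length (level (dim d r) (mid d l)) + s) + y * y ^ d * θ
      ≡⟨ cong (λ z → c * z + y * y ^ d * θ) (sym length≡) ⟩
    c * length (family (suc d) r l) + y * y ^ d * θ     ∎
    where
    Q = 2 ^ K
    c = length (closure P f)
    y = length outsiders
    size-at : Subset K → ℕ
    size-at T = length (family d r (start d l T))
    s = ∑ outsiders size-at
    eq : ∀ c m s y z θ → c * m + (c * s + y * (z * θ)) ≡ c * (m + s) + y * z * θ
    eq = solve-∀
    length≡ : length (family (suc d) r l) ≡ length (level (dim d r) (mid d l)) + s
    length≡ = trans (length-++ (map translate (level (dim d r) (mid d l))))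
      (cong₂ _+_ (length-map _ (level (dim d r) (mid d l))) (length-parts d r l))
    lo≤l : lo + d * K ≤ l
    lo≤l = ≤-trans (+-monoʳ-≤ lo (m≤n+m (d * K) K)) lo≤
    V = suc K * suc (width d)
    middle : Q ^ d * θ ≤ length (level (dim d r) (mid d l))
    middle = begin
      Q ^ d * θ                              ≡⟨ cong (_* θ) (trans (^-*-assoc 2 K d) (cong (2 ^_) (*-comm K d))) ⟩
      2 ^ (d * K) * θ                        ≤⟨ binomial-doubling-lower θ≤ (d * K) (mid d l) (≤-trans lo≤l (m≤m+n l _)) mid≤hi ⟩
      (d * K + r) C mid d l                  ≡⟨ cong (_C mid d l) (sym (dim≡ d r)) ⟩
      dim d r C mid d l                      ≡⟨ sym (length-level (dim d r) (mid d l)) ⟩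
      length (level (dim d r) (mid d l))     ∎
      where
      mid≤hi : mid d l ≤ hi
      mid≤hi = ≤-trans (+-monoʳ-≤ l (m≤n⇒m≤1+n (≤-trans (m≤m+n V V) (m≤m+n _ K)))) ≤hi
    each : ∀ T → Q ^ d * θ ≤ c * size-at T + y ^ d * θ
    each T = family-size θ≤ d (start d l T) (≤-trans lo≤l (≤-trans (l≤base d l T) (m≤m+n _ _)))
      (≤-trans (m≤m+n _ K) (≤-trans (start+width≤ d l T) ≤hi))
    parts : y * (Q ^ d * θ) ≤ c * s + y * (y ^ d * θ)
    parts = begin
      y * (Q ^ d * θ)                                     ≡⟨ sym (∑-const outsiders _) ⟩
      ∑ outsiders (λ _ → Q ^ d * θ)                       ≤⟨ ∑-mono outsiders each ⟩
      ∑ outsiders (λ T → c * size-at T + y ^ d * θ)       ≡⟨ ∑-distrib-+ outsiders _ _ ⟩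
      ∑ outsiders (λ T → c * size-at T) + ∑ outsiders (λ _ → y ^ d * θ)
        ≡⟨ cong₂ _+_ (∑-distribˡ-* outsiders c size-at) (∑-const outsiders _) ⟩
      c * s + y * (y ^ d * θ)                             ∎

allPairs-lookup : ∀ {A : Set} {R : A → A → Set} {xs} → (∀ {x y} → R x y → R y x) → AllPairs R xs →
  ∀ i j → i ≢ j → R (List.lookup xs i) (List.lookup xs j)
allPairs-lookup R-sym (Rx ∷ Rxs) zero    zero    i≢j = ⊥-elim (i≢j refl)
allPairs-lookup R-sym (Rx ∷ Rxs) zero    (suc j) i≢j = All.lookup Rx (∈-lookup j)
allPairs-lookup R-sym (Rx ∷ Rxs) (suc i) zero    i≢j = R-sym (All.lookup Rx (∈-lookup i))
allPairs-lookup R-sym (Rx ∷ Rxs) (suc i) (suc j) i≢j = allPairs-lookup R-sym Rxs i j (λ eq → i≢j (cong suc eq))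

-- Asymptotics

∣-∣-bound : ∀ {x y z} → x ≤ y + z → y ≤ x + z → ∣ x - y ∣ ≤ z
∣-∣-bound {x} {y} {z} x≤ y≤ with ∣m-n∣≡[m∸n]∨[n∸m] x y
... | inj₁ eq = ≤-trans (≤-reflexive eq) (m≤n+o⇒m∸n≤o x y x≤)
... | inj₂ eq = ≤-trans (≤-reflexive eq) (m≤n+o⇒m∸n≤o y x y≤)

-- The hypothesis `c/n ≤ 1/(k + 2)` is the right one because `1 / (1 - 1/(k + 2)) = 1 + 1/(k + 1)`.
upper-arithmetic : ∀ {k n x B c} .{{_ : NonZero n}} → c * (2 + k) ≤ n → n * x ≤ n * B + c * x → suc k * x ≤ suc k * B + B
upper-arithmetic {k} {n} {x} {B} {c} c≤ bound = *-cancelˡ-≤ n (+-cancelʳ-≤ (n * x) _ _ (begin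
  n * (suc k * x) + n * x                 ≡⟨ eq₁ n k x ⟩
  (2 + k) * (n * x)                       ≤⟨ *-monoʳ-≤ (2 + k) bound ⟩
  (2 + k) * (n * B + c * x)               ≡⟨ eq₂ n k x B c ⟩
  n * (suc k * B + B) + c * (2 + k) * x   ≤⟨ +-monoʳ-≤ (n * (suc k * B + B)) (*-monoˡ-≤ x c≤) ⟩
  n * (suc k * B + B) + n * x             ∎))
  where
  open ≤-Reasoning
  eq₁ : ∀ n k x → n * (suc k * x) + n * x ≡ (2 + k) * (n * x)
  eq₁ = solve-∀
  eq₂ : ∀ n k x B c → (2 + k) * (n * B + c * x) ≡ n * (suc k * B + B) + c * (2 + k) * x
  eq₂ = solve-∀

-- (1 − 1/2q)² ≥ 1 − 1/q for q = suc k, one factor for the density y of uncovered blocks and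
-- one for the loss θ/β against the central binomial coefficient.
lower-arithmetic : ∀ k {D θ β B x y} → D * θ ≤ x + y * θ → 2 * suc k * y ≤ D → 2 * suc k * β ≤ 2 * suc k * θ + β →
  B ≤ D * β → suc k * B ≤ suc k * x + B
lower-arithmetic k {D} {θ} {β} {B} {x} {y} tiled y≤ β≤ B≤ = begin
  suc k * B             ≡⟨ +-comm B (k * B) ⟩
  k * B + B             ≤⟨ +-monoˡ-≤ B (≤-trans (*-monoʳ-≤ k B≤) kDβ≤) ⟩
  suc k * x + B         ∎
  where
  open ≤-Reasoning
  Dθ≤ : suc (2 * k) * (D * θ) ≤ 2 * suc k * x
  Dθ≤ = +-cancelʳ-≤ (D * θ) _ _ (begin
    suc (2 * k) * (D * θ) + D * θ        ≡⟨ eq k (D * θ) ⟩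
    2 * suc k * (D * θ)                  ≤⟨ *-monoʳ-≤ (2 * suc k) tiled ⟩
    2 * suc k * (x + y * θ)              ≡⟨ *-distribˡ-+ (2 * suc k) x (y * θ) ⟩
    2 * suc k * x + 2 * suc k * (y * θ)  ≡⟨ cong (2 * suc k * x +_) (sym (*-assoc (2 * suc k) y θ)) ⟩
    2 * suc k * x + 2 * suc k * y * θ    ≤⟨ +-monoʳ-≤ (2 * suc k * x) (*-monoˡ-≤ θ y≤) ⟩
    2 * suc k * x + D * θ                ∎)
    where
    eq : ∀ k z → suc (2 * k) * z + z ≡ 2 * suc k * z
    eq = solve-∀
  θ≥ : suc (2 * k) * β ≤ 2 * suc k * θ
  θ≥ = +-cancelʳ-≤ β _ _ (≤-trans (≤-reflexive (eq k β)) β≤)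
    where
    eq : ∀ k z → suc (2 * k) * z + z ≡ 2 * suc k * z
    eq = solve-∀
  kDβ≤ : k * (D * β) ≤ suc k * x
  kDβ≤ = *-cancelˡ-≤ (4 * suc k) {{m*n≢0 4 (suc k)}} (begin
    4 * suc k * (k * (D * β))                        ≤⟨ m≤m+n _ (D * β) ⟩
    4 * suc k * (k * (D * β)) + D * β                ≡⟨ eq₁ k D β ⟩
    suc (2 * k) * (D * (suc (2 * k) * β))            ≤⟨ *-monoʳ-≤ (suc (2 * k)) (*-monoʳ-≤ D θ≥) ⟩
    suc (2 * k) * (D * (2 * suc k * θ))              ≡⟨ eq₂ (suc (2 * k)) D (2 * suc k) θ ⟩
    2 * suc k * (suc (2 * k) * (D * θ))              ≤⟨ *-monoʳ-≤ (2 * suc k) Dθ≤ ⟩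
    2 * suc k * (2 * suc k * x)                      ≡⟨ eq₃ k x ⟩
    4 * suc k * (suc k * x)                          ∎)
    where
    eq₁ : ∀ k D β → 4 * suc k * (k * (D * β)) + D * β ≡ suc (2 * k) * (D * (suc (2 * k) * β))
    eq₁ = solve-∀
    eq₂ : ∀ a D b θ → a * (D * (b * θ)) ≡ b * (a * (D * θ))
    eq₂ = solve-∀
    eq₃ : ∀ k x → 2 * suc k * (2 * suc k * x) ≡ 4 * suc k * (suc k * x)
    eq₃ = solve-∀

-- By `binomial-near-central` the gap to the central coefficient is at most the fraction `X²/h` of
-- it, hence at most `1/s` once `h ≥ s * suc (X * X)`. The window is one-sided because all levels in
-- use lie at or above the middle.
flat-window : ∀ {s X r} .{{_ : NonZero s}} → s * suc (X * X) * 2 ≤ r →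
  ∃[ θ ] ((s * centralBinom r ≤ s * θ + centralBinom r) × (∀ j → half r ≤ j → j ≤ half r + X → θ ≤ r C j))
flat-window {s} {X} {r} r≥ = θ , θ-large , θ≤
  where
  open ≤-Reasoning
  β = centralBinom r
  h = half r
  -- The successor keeps `Y` nonzero, so that it can be cancelled even when `X` is 0.
  Y = suc (X * X)
  ε = β / s
  θ = β ∸ ε
  ε*s≤β : ε * s ≤ β
  ε*s≤β = m/n*n≤m β s
  θ-large : s * β ≤ s * θ + β
  θ-large = begin
    s * β           ≤⟨ *-monoʳ-≤ s (m≤n+m∸n β ε) ⟩
    s * (ε + θ)     ≡⟨ trans (*-distribˡ-+ s ε θ) (trans (+-comm (s * ε) (s * θ)) (cong (s * θ +_) (*-comm s ε))) ⟩
    s * θ + ε * s   ≤⟨ +-monoʳ-≤ (s * θ) ε*s≤β ⟩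
    s * θ + β       ∎
  h≥ : s * Y ≤ h
  h≥ = subst (_≤ h) (m*n/n≡m (s * Y) 2) (/-monoˡ-≤ 2 r≥)
  θ≤ : ∀ j → h ≤ j → j ≤ h + X → θ ≤ r C j
  θ≤ j h≤j j≤ = m≤n+o⇒m∸n≤o β ε (≤-trans (m≤n+m∸n β (r C j)) (≤-trans (+-monoʳ-≤ (r C j) gap≤ε) (≤-reflexive (+-comm (r C j) ε))))
    where
    i = j ∸ h
    gap = β ∸ (r C j)
    i≤X : i ≤ X
    i≤X = m≤n+o⇒m∸n≤o j h j≤
    near : h * β ≤ h * (r C j) + Y * β
    near = begin
      h * β                          ≤⟨ binomial-near-central r i ⟩
      h * (r C (h + i)) + i * i * β  ≡⟨ cong (λ z → h * (r C z) + i * i * β) (m+[n∸m]≡n h≤j) ⟩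
      h * (r C j) + i * i * β        ≤⟨ +-monoʳ-≤ (h * (r C j)) (*-monoˡ-≤ β (m≤n⇒m≤1+n (*-mono-≤ i≤X i≤X))) ⟩
      h * (r C j) + Y * β            ∎
    Y-gap : Y * (gap * s) ≤ Y * β
    Y-gap = begin
      Y * (gap * s)            ≡⟨ eq Y gap s ⟩
      s * Y * gap              ≤⟨ *-monoˡ-≤ gap h≥ ⟩
      h * gap                  ≡⟨ *-distribˡ-∸ h β (r C j) ⟩
      h * β ∸ h * (r C j)      ≤⟨ m≤n+o⇒m∸n≤o (h * β) (h * (r C j)) near ⟩
      Y * β                    ∎
      where
      eq : ∀ Y g s → Y * (g * s) ≡ s * Y * g
      eq = solve-∀
    gap≤ε : gap ≤ ε
    gap≤ε = subst (_≤ ε) (m*n/n≡m gap s) (/-monoˡ-≤ s (*-cancelˡ-≤ Y Y-gap))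

-- `K` is the dimension after merging, and `Q` counts the blocks and bounds c*. Two losses of `1/s`
-- each are allowed; `d = s * Q` makes `Q/(Q + d)` at most `1/s`. `X` is the span of levels
-- required: `d * K` for Pascal's rule plus the outermost band. The summands of `threshold` provide,
-- in turn, `n > 0`, room for the `d * K` coordinates, the flat window, and `c * (2 + k) ≤ n`.
module Constants (p k : ℕ) where
  K Q s d X threshold : ℕ
  K = 2 ^ p
  Q = 2 ^ K
  s = 2 * suc k
  d = s * Q
  X = d * K + bandWidth K d
  threshold = suc (d * K + s * suc (X * X) * 2 + Q * (2 + k))

-- Both bounds beyond the threshold

module _ (P : FinPoset) (k : ℕ) where

  open Constants (size P) k

  cStar≤ : ∀ {c} → IsCStar P c → c ≤ Q
  cStar≤ ((_ , f , emb , _) , min) = ≤-trans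
    (min _ (K , merged , strongEmbedding-resp P merged-sameOrder emb , hasSize-closure P merged))
    (≤-trans (length-filter (inConvexClosure? P merged) (subsets K)) (≤-reflexive (length-subsets K)))
    where open Merge f

  merged-closure≤ : ∀ {c j} (f : Fin (size P) → _) → HasSize (InConvexClosure P j f) c →
    length (closure P (Merge.merged f)) ≤ c
  merged-closure≤ f (xs , _ , char , refl) = ≤-trans (closure-merged P f)
    (unique-⊆⇒length≤ (closure-unique P f) (λ {S} S∈ → Equivalence.from (char S) (∈-closure⁻ P f S∈)))

  upper : ∀ {n m c} → threshold ≤ n → LaAchievable P n m → IsCStar P c →
    suc k * (m * c) ≤ suc k * (size P * centralBinom n) + size P * centralBinom n
  upper {n} {m} {c} N≤n (t , F , emb , unrel , hasSize) cStar = begin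
    suc k * (m * c)                        ≤⟨ *-monoʳ-≤ (suc k) (*-monoˡ-≤ c (union-size≤ P F hasSize)) ⟩
    suc k * (t * size P * c)               ≡⟨ eq₁ (suc k) t (size P) c ⟩
    size P * (suc k * (t * c))             ≤⟨ *-monoʳ-≤ (size P) (upper-arithmetic {k} {n} {t * c} {centralBinom n} {c} c-small
                                                (copies-bound P F emb unrel (proj₂ cStar) (≤-trans (m≤m*n c (2 + k)) c-small))) ⟩
    size P * (suc k * centralBinom n + centralBinom n) ≡⟨ eq₂ (suc k) (size P) (centralBinom n) ⟩
    suc k * (size P * centralBinom n) + size P * centralBinom n ∎
    where
    open ≤-Reasoning
    instance
      n≢0 : NonZero n
      n≢0 = >-nonZero (≤-trans (s≤s z≤n) N≤n)
    c-small : c * (2 + k) ≤ n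
    c-small = ≤-trans (*-monoˡ-≤ (2 + k) (cStar≤ cStar)) (≤-trans (m≤n⇒m≤1+n (m≤n+m _ _)) N≤n)
    eq₁ : ∀ q t p c → q * (t * p * c) ≡ p * (q * (t * c))
    eq₁ = solve-∀
    eq₂ : ∀ q p b → p * (q * b + b) ≡ q * (p * b) + p * b
    eq₂ = solve-∀

  many-copies : ∀ {n c} → Fin (size P) → threshold ≤ n → IsCStar P c →
    ∃[ t ] (LaAchievable P n (t * size P) × suc k * centralBinom n ≤ suc k * (c * t) + centralBinom n)
  many-copies {n} {c} a₀ N≤n ((_ , f , emb , hasSize) , _) =
    t , subst (λ n → LaAchievable P n (t * size P)) dim≡n achieved ,
    lower-arithmetic k {Q ^ d} {θ} {centralBinom r} tiled y-small θ-large central≤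
    where
    open ≤-Reasoning
    open Merge f using (merged; merged-sameOrder)
    module M = Tiling P merged
    r = n ∸ d * K
    d*K≤n : d * K ≤ n
    d*K≤n = ≤-trans (m≤n⇒m≤1+n (≤-trans (m≤m+n _ _) (m≤m+n _ _))) N≤n
    r-large : s * suc (X * X) * 2 ≤ r
    r-large = subst (_≤ r) (m+n∸m≡n (d * K) _) (∸-monoˡ-≤ (d * K) (≤-trans (m≤n⇒m≤1+n (m≤m+n _ _)) N≤n))
    dim≡n : M.dim d r ≡ n
    dim≡n = trans (M.dim≡ d r) (m+[n∸m]≡n d*K≤n)
    window = flat-window {s} {X} {r} {{m*n≢0 2 (suc k)}} r-large
    θ = proj₁ window
    θ-large = proj₁ (proj₂ window)
    -- The lowest coefficients reached by Pascal's rule then sit exactly at `half r`, and the top of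
    -- the band at `half r + X`.
    l = half r + d * K
    copies = M.family d r l
    t = length copies
    y = length M.outsiders
    F : Fin t → Fin (size P) → _
    F = List.lookup copies
    emb-F : ∀ i → StrongEmbedding P (M.dim d r) (F i)
    emb-F i = strongEmbedding-resp P (All.lookup (M.family-sameOrder d r l) (∈-lookup i))
      (strongEmbedding-resp P merged-sameOrder emb)
    unrel-F : PairwiseUnrelated P (M.dim d r) t F
    unrel-F i j i≢j = allPairs-lookup (λ unrel a b → (proj₂ (unrel b a) , proj₁ (unrel b a))) (M.family-unrelated d r l) i j i≢j
    achieved : LaAchievable P (M.dim d r) (t * size P)
    achieved = t , F , emb-F , unrel-F , union-size P F emb-F unrel-F
    tiled : Q ^ d * θ ≤ c * t + y ^ d * θ
    tiled = ≤-trans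
      (M.family-size (proj₂ (proj₂ window)) d l ≤-refl (≤-reflexive (+-assoc (half r) (d * K) _)))
      (+-monoˡ-≤ (y ^ d * θ) (*-monoˡ-≤ t (merged-closure≤ f hasSize)))
    y<Q : suc y ≤ Q
    -- The element `a₀` makes the closure nonempty; otherwise no block would be filled and the
    -- uncovered fraction would not decay.
    y<Q = ≤-trans (+-monoˡ-≤ y (nonempty (∈-closure⁺ P merged {merged a₀} (a₀ , a₀ , ⊆-refl , ⊆-refl)))) (≤-reflexive M.closure+outsiders)
      where
      nonempty : ∀ {A : Set} {x : A} {xs} → x ∈ˡ xs → 1 ≤ length xs
      nonempty (here _)  = s≤s z≤n
      nonempty (there _) = s≤s z≤n
    y-small : s * y ^ d ≤ Q ^ d
    y-small = *-cancelˡ-≤ Q {{m^n≢0 2 K}} (begin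
      Q * (s * y ^ d)      ≡⟨ trans (sym (*-assoc Q s _)) (cong (_* y ^ d) (*-comm Q s)) ⟩
      d * y ^ d            ≤⟨ *-monoˡ-≤ (y ^ d) (m≤n+m d Q) ⟩
      (Q + d) * y ^ d      ≤⟨ geometric-decay y<Q d ⟩
      Q * Q ^ d            ∎)
    central≤ : centralBinom n ≤ Q ^ d * centralBinom r
    central≤ = begin
      centralBinom n                 ≡⟨ cong (λ z → z C half n) (sym (m+[n∸m]≡n d*K≤n)) ⟩
      (d * K + r) C half n           ≤⟨ binomial-doubling-upper (d * K) r (half n) ⟩
      2 ^ (d * K) * centralBinom r   ≡⟨ cong (_* centralBinom r) (trans (cong (2 ^_) (*-comm d K)) (sym (^-*-assoc 2 K d))) ⟩
      Q ^ d * centralBinom r         ∎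

  lower-nonempty : ∀ {n m c} → Fin (size P) → threshold ≤ n → IsLa P n m → IsCStar P c →
    suc k * (size P * centralBinom n) ≤ suc k * (m * c) + size P * centralBinom n
  lower-nonempty {n} {m} {c} a₀ N≤n (_ , max) cStar = begin
    suc k * (size P * β)                       ≡⟨ eq₁ (suc k) (size P) β ⟩
    size P * (suc k * β)                       ≤⟨ *-monoʳ-≤ (size P) (proj₂ (proj₂ packed)) ⟩
    size P * (suc k * (c * t) + β)             ≡⟨ eq₂ (suc k) (size P) c t β ⟩
    suc k * (t * size P * c) + size P * β      ≤⟨ +-monoˡ-≤ (size P * β) (*-monoʳ-≤ (suc k) (*-monoˡ-≤ c (max _ (proj₁ (proj₂ packed))))) ⟩
    suc k * (m * c) + size P * β               ∎
    where
    open ≤-Reasoning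
    packed = many-copies a₀ N≤n cStar
    t = proj₁ packed
    β = centralBinom n
    eq₁ : ∀ q p b → q * (p * b) ≡ p * (q * b)
    eq₁ = solve-∀
    eq₂ : ∀ q p c t b → p * (q * (c * t) + b) ≡ q * (t * p * c) + p * b
    eq₂ = solve-∀

  lower : ∀ {n m c} → threshold ≤ n → IsLa P n m → IsCStar P c →
    suc k * (size P * centralBinom n) ≤ suc k * (m * c) + size P * centralBinom n
  lower {n} N≤n la cStar = [ (λ 0<p → lower-nonempty (fromℕ< 0<p) N≤n la cStar)
                           , (λ 0≡p → ≤-trans (≤-reflexive (trans (cong (λ z → suc k * (z * centralBinom n)) (sym 0≡p)) (*-zeroʳ (suc k)))) z≤n) ]′ (m≤n⇒m<n∨m≡n {0} {size P} z≤n)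

-- Here `1/(k+1)` is the relative tolerance. Multiplying by `c` avoids the quotient of `size P` by
-- c*, which is 0/0 for the empty poset.
theorem4 : (P : FinPoset) → (k : ℕ) → ∃[ N ] (∀ n → N ≤ n → ∀ m c → IsLa P n m → IsCStar P c → suc k * ∣ m * c - size P * centralBinom n ∣ ≤ size P * centralBinom n)
theorem4 P k = Constants.threshold (size P) k , λ n N≤n m c la cStar →
  ≤-trans (≤-reflexive (*-distribˡ-∣-∣ (suc k) (m * c) (size P * centralBinom n)))
    (∣-∣-bound (upper P k N≤n (proj₁ la) cStar) (lower P k N≤n la cStar))
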